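{- Let $\mathcal H$ be a $\Sigma$-interpretation, $\varsigma$ a valuation to $\mathcal H$, $r$ a term over $\Sigma$, and $l\in|\mathbb L|$. If $\mathrm{atoms}(r)\cap\mathrm{supp}(l)=\varnothing$, then $$[\![r]\!]^{[l]\mathcal H}_{[l]\varsigma}=[l]\,[\![r]\!]^{\mathcal H}_{\varsigma}.$$
   Context: **Atoms and permissive-nominal sets.** For each $i\in\mathbb N$ fix countably infinite sets of atoms $\mathbb A^<_i,\mathbb A^>_i$ (all these sets pairwise disjoint). Write $\mathbb A_i=\mathbb A^<_i\cup\mathbb A^>_i$, $\mathbb A^<=\bigcup_i\mathbb A^<_i$, $\mathbb A^>=\bigcup_i\mathbb A^>_i$, $\mathbb A=\mathbb A^<\cup\mathbb A^>$. A permutation is an element of the group $\mathbb P_{fin}$ of bijections of $\mathbb A$ generated by swappings $(a\ b)$ with $a,b$ in the same $\mathbb A_i$; $\mathrm{nontriv}(\pi)=\{a\mid\pi(a)\neq a\}$. For $A\subseteq\mathbb A$, $\pi\cdot A=\{\pi(a)\mid a\in A\}$ and $\mathrm{fix}(A)=\{\pi\mid\forall a\in A.\ \pi(a)=a\}$. A permission set is a set of the form $\pi\cdot\mathbb A^<$. A set with a permutation action $\mathsf X$ is a carrier set $|\mathsf X|$ with a group action of $\mathbb P_{fin}$, written $\pi\cdot x$. $A\subseteq\mathbb A$ supports $x\in|\mathsf X|$ when every $\pi\in\mathrm{fix}(A)$ satisfies $\pi\cdot x=x$. $\mathsf X$ is a permissive-nominal set when every $x\in|\mathsf X|$ has a unique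 least supporting set $\mathrm{supp}(x)$ and this is contained in some permission set. A function $F:|\mathsf X|\to|\mathsf Y|$ is equivariant when $F(\pi\cdot x)=\pi\cdot F(x)$ for all $\pi,x$. Atoms have action $\pi\cdot a=\pi(a)$; finite products have the componentwise action. For $a\in\mathbb A_\nu$, $x\in|\mathsf X|$, the abstraction is $[a]x=\{(a,x)\}\cup\{(b,(b\ a)\cdot x)\mid b\in\mathbb A_\nu\setminus\mathrm{supp}(x),\ b\neq a\}$; $[\mathbb A_\nu]\mathsf X$ has carrier $\{[a]x\mid a\in\mathbb A_\nu,x\in|\mathsf X|\}$ and action $\pi\cdot[a]x=[\pi(a)]\pi\cdot x$. **Signatures and terms.** A signature $\Sigma$ consists of: name sorts $\mathcal A\subseteq\mathbb N$ (ranged over by $\nu$) and base sorts $\mathcal B$ (ranged over by $\tau$), giving sorts $\alpha::=\nu\mid\tau\mid(\alpha,\dots,\alpha)\mid[\nu]\alpha$; constants $C$, each with a base sort $\mathrm{sort}(C)$ and a set $\mathrm{pmss}(C)\subseteq\mathbb A^<$; unknowns $X$, each with a sort $\mathrm{sort}(X)$; term-formers $\mathsf f$, each with an arity $(\alpha)\tau$. Terms: $a:\nu$ for $a\in\mathbb A_\nu$, $\nu\in\mathcal A$; $\pi\cdot C:\mathrm{sort}(C)$; $\pi\cdot X:\mathrm{sort}(X)$; $\mathsf f(r):\tau$ if $r:\alpha$ and $\mathsf f$ has arity $(\alpha)\tau$; $(r_1,\dots,r_n):(\alpha_1,\dots,\alpha_n)$ if $r_i:\alpha_i$; $[a]r:[\nu]\alpha$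 if $a\in\mathbb A_\nu$, $\nu\in\mathcal A$, $r:\alpha$. **Interpretations.** A $\Sigma$-interpretation $\mathcal H$ assigns to each sort $\alpha$ a permissive-nominal set $[\![\alpha]\!]^{\mathcal H}$, together with: equivariant injective maps $\mathbb A_\nu\to[\![\nu]\!]^{\mathcal H}$, written $a^{\mathcal H}$; $[\mathbb A_\nu][\![\alpha]\!]^{\mathcal H}\to[\![[\nu]\alpha]\!]^{\mathcal H}$, written $[a]^{\mathcal H}x$; $\prod_i[\![\alpha_i]\!]^{\mathcal H}\to[\![(\alpha_1,\dots,\alpha_n)]\!]^{\mathcal H}$, written $(x_1,\dots,x_n)^{\mathcal H}$; an equivariant map $\mathsf f^{\mathcal H}:[\![\alpha]\!]^{\mathcal H}\to[\![\tau]\!]^{\mathcal H}$ for each $\mathsf f$ of arity $(\alpha)\tau$; and $C^{\mathcal H}\in[\![\mathrm{sort}(C)]\!]^{\mathcal H}$ with $\mathrm{supp}(C^{\mathcal H})\subseteq\mathrm{pmss}(C)$ for each $C$. A valuation $\varsigma$ to $\mathcal H$ maps each unknown $X$ to some $\varsigma(X)\in[\![\mathrm{sort}(X)]\!]^{\mathcal H}$ with $\mathrm{supp}(\varsigma(X))\subseteq\mathbb A^<$. Terms: $[\![a]\!]^{\mathcal H}_\varsigma=a^{\mathcal H}$, $[\![\pi\cdot C]\!]^{\mathcal H}_\varsigma=\pi\cdot C^{\mathcal H}$, $[\![\pi\cdot X]\!]^{\mathcal H}_\varsigma=\pi\cdot\varsigma(X)$, $[\![\mathsf f(r)]\!]^{\mathcal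 H}_\varsigma=\mathsf f^{\mathcal H}([\![r]\!]^{\mathcal H}_\varsigma)$, $[\![(r_1,\dots,r_n)]\!]^{\mathcal H}_\varsigma=([\![r_1]\!]^{\mathcal H}_\varsigma,\dots,[\![r_n]\!]^{\mathcal H}_\varsigma)^{\mathcal H}$, $[\![[a]r]\!]^{\mathcal H}_\varsigma=[a]^{\mathcal H}[\![r]\!]^{\mathcal H}_\varsigma$. **Lists and abstraction by lists.** Fix an arbitrary enumeration $l_\ast=[a_{ -1},a_{ -2},a_{ -3},\dots]$ (an infinite list of distinct atoms) of some subset of $\mathbb A^<$. $\mathbb L$ is the permissive-nominal set with carrier $\{\pi\cdot l_\ast\mid\pi\text{ a permutation}\}$, permutations acting elementwise on lists; $\mathrm{supp}(l)$ is the set of atoms in $l$. For $x$ in a permissive-nominal set $\mathsf X$ and $l\in|\mathbb L|$, $[l]x=\{(\pi\cdot l,\pi\cdot x)\mid\pi\in\mathrm{fix}(\mathrm{supp}(x)\setminus\mathrm{supp}(l))\}$, with action $\pi\cdot[l]x=[\pi\cdot l]\pi\cdot x$. **The interpretation $[m]\mathcal H$.** For $m\in|\mathbb L|$, $[m]\mathcal H$ is the $\Sigma$-interpretation with $[\![\alpha]\!]^{[m]\mathcal H}=\{[l]x\mid l\in|\mathbb L|,x\in[\![\alpha]\!]^{\mathcal H}\}$ and: $a^{[m]\mathcal H}=[l](a^{\mathcal H})$ for any $l$ with $a\notin\mathrm{supp}(l)$; $\mathsf f^{[m]\mathcal H}([l]x)=[l]\mathsf f^{\mathcal H}(x)$;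 $([l]x_1,\dots,[l]x_n)^{[m]\mathcal H}=[l](x_1,\dots,x_n)^{\mathcal H}$ (finitely many elements can always be written using a common $l$); $[a]^{[m]\mathcal H}([l]x)=[l]([a]^{\mathcal H}x)$ where $l$ is chosen with $a\notin\mathrm{supp}(l)$; $C^{[m]\mathcal H}=[m]C^{\mathcal H}$. In particular $[l]\mathcal H$ is the case $m=l$. The valuation $[l]\varsigma$ is defined by $([l]\varsigma)(X)=[l](\varsigma(X))$. **$\pi/S$ and $\mathrm{atoms}(r)$.** For a permutation $\pi$ and $S\subseteq\mathbb A$, $\pi/S$ is the permutation obtained from the cycle representation of $\pi$ (cycles of length $>1$) by: (1) repeatedly deleting from its cycle any atom that is not in $S$ and whose immediate predecessor and successor in the cycle are not in $S$, until no such atom remains; then (2) wherever a cycle contains consecutive $a_1\,a_2\,a_3\,a_4$ with $a_1,a_4\in S$ and $a_2,a_3\notin S$, breaking the cycle between $a_2$ and $a_3$, i.e. `$a_1\ a_2)(a_3\ a_4$'. (E.g. $(a\,b\,c\,d\,e\,f)/\{b,e\}=(a\,b\,c)(d\,e\,f)$ and $(a\,b\,c\,d\,e\,f)/\{b\}=(a\,b\,c)$.) Define $\mathrm{atoms}(a)=\{a\}$, $\mathrm{atoms}(\pi\cdot C)=\mathrm{nontriv}(\pi/\mathrm{pmss}(C))$, $\mathrm{atoms}(\pi\cdot X)=\mathrm{nontriv}(\pi/\mathbb A^<)$, $\mathrm{atoms}(\mathsf f(r))=\mathrm{atoms}(r)$, $\mathrm{atoms}((r_1,\dots,r_n))=\bigcup_i\mathrm{atoms}(r_i)$,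 $\mathrm{atoms}([a]r)=\mathrm{atoms}(r)\cup\{a\}$. -}

module Defs where

open import Algebra.Bundles using (Group)
open import Axiom.ExcludedMiddle using (ExcludedMiddle)
open import Data.Bool.Base using (Bool; true; false; not; _∧_; if_then_else_)
open import Data.Empty using (⊥-elim)
open import Data.List.Base using (List; []; _∷_; _++_; [_]; concatMap; foldr; filter; deduplicate; length; reverse)
open import Data.List.Membership.Propositional using () renaming (_∈_ to _∈ₗ_; _∉_ to _∉ₗ_)
open import Data.List.Membership.Propositional.Properties using (∈-++⁺ˡ; ∈-++⁺ʳ)
open import Data.List.Properties using (foldr-++; unfold-reverse)
open import Data.List.Relation.Unary.All using (All; []; _∷_)
open import Data.List.Relation.Unary.Any using (here; there; any?)
open import Data.Nat.Base using (ℕ; zero; suc; _≤_; _⊔_)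
import Data.Nat.Properties as ℕ
open import Data.Nat.GeneralisedArithmetic using (fold)
open import Data.Product.Base using (∃; _×_; _,_; proj₁; proj₂)
open import Data.Product.Relation.Binary.Pointwise.NonDependent using (×-setoid)
open import Data.Sum.Base using (_⊎_; inj₁; inj₂)
open import Data.Unit.Base using (⊤; tt)
open import Function.Base using (_∘_; _on_)
open import Function.Bundles using (Func; Injection)
open import Level using (0ℓ)
open import Relation.Binary.Bundles using (Setoid)
open import Relation.Binary.Definitions using (DecidableEquality)
import Relation.Binary.PropositionalEquality as ≡
open ≡ using (_≡_; _≢_; refl; sym; trans; cong; subst; module ≡-Reasoning)
open import Relation.Nullary.Decidable using (Dec; yes; no; does; map′; _×-dec_; ¬?; dec-true; dec-false)
open import Relation.Nullary.Negation using (¬_; contradiction)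
open import Relation.Unary using (Pred; Decidable; _∈_; _∉_; _⊆_; _≐_; _∪_; _∩_; ∅; ∁; ｛_｝)

-- 𝔸<ᵢ and 𝔸>ᵢ are the atoms of sort i on the lower, resp. upper, side.

data Side : Set where
  lower upper : Side

record Atom : Set where
  constructor atom
  field
    sort  : ℕ
    side  : Side
    index : ℕ

open Atom public

𝔸< : Pred Atom 0ℓ
𝔸< a = side a ≡ lower

𝔸 : ℕ → Set
𝔸 ν = ∃ λ a → sort a ≡ ν

_≟ₛ_ : DecidableEquality Side
lower ≟ₛ lower = yes refl
lower ≟ₛ upper = no λ ()
upper ≟ₛ lower = no λ ()
upper ≟ₛ upper = yes refl

infix 4 _≟_

_≟_ : DecidableEquality Atom
atom i s n ≟ atom j t m =
  map′ (λ { (refl , refl , refl) → refl }) (λ { refl → refl , refl , refl })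
       (i ℕ.≟ j ×-dec s ≟ₛ t ×-dec n ℕ.≟ m)

_∖_ : Pred Atom 0ℓ → Pred Atom 0ℓ → Pred Atom 0ℓ
A ∖ B = A ∩ ∁ B

record Swapping : Set where
  constructor swapping
  field
    fst snd   : Atom
    same-sort : sort fst ≡ sort snd

open Swapping public

swap : Swapping → Atom → Atom
swap s c = if does (c ≟ fst s) then snd s else if does (c ≟ snd s) then fst s else c

-- The group of bijections generated by the swappings: its elements are words
-- in the generators (which are their own inverses), two words being equal when
-- they denote the same bijection.

Permutation : Set
Permutation = List Swapping

infixr 6 _⟨$⟩_

_⟨$⟩_ : Permutation → Atom → Atom
π ⟨$⟩ a = foldr swap a π

swap-fst : ∀ s → swap s (fst s) ≡ snd s
swap-fst s rewrite dec-true (fst s ≟ fst s) refl = refl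

swap-snd : ∀ s → swap s (snd s) ≡ fst s
swap-snd s with snd s ≟ fst s
... | yes p rewrite dec-true (snd s ≟ fst s) p = p
... | no ¬p rewrite dec-false (snd s ≟ fst s) ¬p | dec-true (snd s ≟ snd s) refl = refl

swap-other : ∀ s {c} → c ≢ fst s → c ≢ snd s → swap s c ≡ c
swap-other s {c} p q rewrite dec-false (c ≟ fst s) p | dec-false (c ≟ snd s) q = refl

data Swapped (s : Swapping) (c : Atom) : Set where
  is-fst : c ≡ fst s → swap s c ≡ snd s → Swapped s c
  is-snd : c ≡ snd s → swap s c ≡ fst s → Swapped s c
  other  : c ≢ fst s → c ≢ snd s → swap s c ≡ c → Swapped s c

swapped : ∀ s c → Swapped s c
swapped s c with c ≟ fst s | c ≟ snd s
... | yes refl | _        = is-fst refl (swap-fst s)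
... | no _     | yes refl = is-snd refl (swap-snd s)
... | no p     | no q     = other p q (swap-other s p q)

swap-involutive : ∀ s c → swap s (swap s c) ≡ c
swap-involutive s c with swapped s c
... | is-fst refl e = trans (cong (swap s) e) (swap-snd s)
... | is-snd refl e = trans (cong (swap s) e) (swap-fst s)
... | other p q e   = trans (cong (swap s) e) e

swap-sort : ∀ s c → sort (swap s c) ≡ sort c
swap-sort s c with swapped s c
... | is-fst refl e = trans (cong sort e) (sym (same-sort s))
... | is-snd refl e = trans (cong sort e) (same-sort s)
... | other p q e   = cong sort e

⟨$⟩-sort : ∀ π a → sort (π ⟨$⟩ a) ≡ sort a
⟨$⟩-sort []      a = refl
⟨$⟩-sort (s ∷ π) a = trans (swap-sort s (π ⟨$⟩ a)) (⟨$⟩-sort π a)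

⟨$⟩-++ : ∀ π ρ a → (π ++ ρ) ⟨$⟩ a ≡ π ⟨$⟩ ρ ⟨$⟩ a
⟨$⟩-++ π ρ a = foldr-++ swap a π ρ

reverse-inverseˡ : ∀ π a → reverse π ⟨$⟩ π ⟨$⟩ a ≡ a
reverse-inverseˡ []      a = refl
reverse-inverseˡ (s ∷ π) a rewrite unfold-reverse s π
  | ⟨$⟩-++ (reverse π) [ s ] (swap s (π ⟨$⟩ a))
  | swap-involutive s (π ⟨$⟩ a) = reverse-inverseˡ π a

reverse-inverseʳ : ∀ π a → π ⟨$⟩ reverse π ⟨$⟩ a ≡ a
reverse-inverseʳ []      a = refl
reverse-inverseʳ (s ∷ π) a rewrite unfold-reverse s π
  | ⟨$⟩-++ (reverse π) [ s ] a
  | reverse-inverseʳ π (swap s a) = swap-involutive s a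

ℙ : Group 0ℓ 0ℓ
ℙ = record
  { Carrier = Permutation
  ; _≈_     = λ π ρ → ∀ a → π ⟨$⟩ a ≡ ρ ⟨$⟩ a
  ; _∙_     = _++_
  ; ε       = []
  ; _⁻¹     = reverse
  ; isGroup = record
    { isMonoid = record
      { isSemigroup = record
        { isMagma = record
          { isEquivalence = record
            { refl  = λ _ → refl
            ; sym   = λ p a → sym (p a)
            ; trans = λ p q a → trans (p a) (q a)
            }
          ; ∙-cong = λ {π} {π′} {ρ} {ρ′} p q a →
              trans (⟨$⟩-++ π ρ a)
                (trans (cong (π ⟨$⟩_) (q a)) (trans (p _) (sym (⟨$⟩-++ π′ ρ′ a))))
          }
        ; assoc = λ π ρ σ a →
            trans (⟨$⟩-++ (π ++ ρ) σ a)
              (trans (⟨$⟩-++ π ρ _)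
                (sym (trans (⟨$⟩-++ π (ρ ++ σ) a) (cong (π ⟨$⟩_) (⟨$⟩-++ ρ σ a)))))
        }
      ; identity = (λ _ _ → refl) , (λ π a → ⟨$⟩-++ π [] a)
      }
    ; inverse = (λ π a → trans (⟨$⟩-++ (reverse π) π a) (reverse-inverseˡ π a))
              , (λ π a → trans (⟨$⟩-++ π (reverse π) a) (reverse-inverseʳ π a))
    ; ⁻¹-cong = λ {π} {ρ} p a →
        trans (sym (cong (reverse π ⟨$⟩_) (trans (p _) (reverse-inverseʳ ρ a))))
          (reverse-inverseˡ π _)
    }
  }

open Group ℙ public using (_∙_; ε; _⁻¹) renaming (_≈_ to _≈ₚ_)

⟨$⟩-injective : ∀ π {a b} → π ⟨$⟩ a ≡ π ⟨$⟩ b → a ≡ b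
⟨$⟩-injective π {a} {b} p =
  trans (sym (reverse-inverseˡ π a)) (trans (cong (π ⁻¹ ⟨$⟩_) p) (reverse-inverseˡ π b))

infixr 6 _$ₙ_

_$ₙ_ : ∀ {ν} → Permutation → 𝔸 ν → 𝔸 ν
π $ₙ (a , a∈ν) = π ⟨$⟩ a , trans (⟨$⟩-sort π a) a∈ν

infix 9 _⇄_

_⇄_ : ∀ {ν} → 𝔸 ν → 𝔸 ν → Permutation
(a , a∈ν) ⇄ (b , b∈ν) = [ swapping a b (trans a∈ν (sym b∈ν)) ]

nontriv : Permutation → Pred Atom 0ℓ
nontriv π a = π ⟨$⟩ a ≢ a

infixr 6 _·ˢ_

_·ˢ_ : Permutation → Pred Atom 0ℓ → Pred Atom 0ℓ
(π ·ˢ A) b = ∃ λ a → a ∈ A × b ≡ π ⟨$⟩ a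

Fix : Pred Atom 0ℓ → Pred Permutation 0ℓ
Fix A π = ∀ {a} → a ∈ A → π ⟨$⟩ a ≡ a

Permitted : Pred Atom 0ℓ → Set
Permitted A = ∃ λ π → A ⊆ π ·ˢ 𝔸<

record ActionSet : Set₁ where
  field
    setoid : Setoid 0ℓ 0ℓ

  open Setoid setoid public renaming (refl to ≈-refl; sym to ≈-sym; trans to ≈-trans)

  infixr 6 _·_

  field
    _·_    : Permutation → Carrier → Carrier
    ·-cong : ∀ {π ρ x y} → π ≈ₚ ρ → x ≈ y → π · x ≈ ρ · y
    ·-ε    : ∀ x → ε · x ≈ x
    ·-∙    : ∀ π ρ x → (π ∙ ρ) · x ≈ π · ρ · x

  Supports : Pred Atom 0ℓ → Carrier → Set
  Supports A x = ∀ π → π ∈ Fix A → π · x ≈ x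

-- Leastness of the support is among the supporting sets contained in some
-- permission set.  Without that restriction 𝔸 ∖ {a} would support everything,
-- as no permutation other than the identity fixes all atoms but one, and every
-- least supporting set would be empty.

record PNominalSet : Set₁ where
  field
    actionSet : ActionSet

  open ActionSet actionSet public

  field
    supp           : Carrier → Pred Atom 0ℓ
    supp-supports  : ∀ x → Supports (supp x) x
    supp-permitted : ∀ x → Permitted (supp x)
    supp-least     : ∀ x A → Permitted A → Supports A x → supp x ⊆ A

∣_∣ : PNominalSet → Set
∣ X ∣ = PNominalSet.Carrier X

record _⟶ᴱ_ (X Y : ActionSet) : Set where
  private
    module X = ActionSet X
    module Y = ActionSet Y
  field
    func        : Func X.setoid Y.setoid
  open Func func public using (to; cong)
  field
    equivariant : ∀ π x → to (π X.· x) Y.≈ π Y.· to x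

record _↣ᴱ_ (X Y : ActionSet) : Set where
  private
    module X = ActionSet X
    module Y = ActionSet Y
  field
    injection   : Injection X.setoid Y.setoid
  open Injection injection public using (to; cong; injective)
  field
    equivariant : ∀ π x → to (π X.· x) Y.≈ π Y.· to x

mentions : Permutation → List Atom
mentions = concatMap (λ s → fst s ∷ snd s ∷ [])

bound : List Atom → ℕ
bound = foldr (λ a n → suc (index a) ⊔ n) 0

unmentioned-fixed : ∀ π {a} → a ∉ₗ mentions π → π ⟨$⟩ a ≡ a
unmentioned-fixed []      p = refl
unmentioned-fixed (s ∷ π) {a} p rewrite unmentioned-fixed π {a} (p ∘ there ∘ there) =
  swap-other s (p ∘ here) (p ∘ there ∘ here)

bound-∉ : ∀ as {a} → bound as ≤ index a → a ∉ₗ as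
bound-∉ (b ∷ as) le (here refl) = ℕ.<-irrefl refl (ℕ.≤-trans (ℕ.m≤m⊔n _ (bound as)) le)
bound-∉ (b ∷ as) le (there p)   = bound-∉ as (ℕ.≤-trans (ℕ.m≤n⊔m (suc (index b)) _) le) p

upper-∉ : ∀ π {a} → side a ≡ upper → bound (mentions π) ≤ index a → a ∉ π ·ˢ 𝔸<
upper-∉ π {a} up le (b , b< , a≡πb)
  with refl ← ⟨$⟩-injective π (trans (unmentioned-fixed π (bound-∉ (mentions π) le)) a≡πb)
  with () ← trans (sym up) b<

·ˢ-permitted : ∀ π {A} → Permitted A → Permitted (π ·ˢ A)
·ˢ-permitted π (ρ , A⊆) = π ∙ ρ , λ { (a , a∈A , refl) →
  let (b , b< , a≡) = A⊆ a∈A in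
  b , b< , trans (cong (π ⟨$⟩_) a≡) (sym (⟨$⟩-++ π ρ b)) }

singleton-permitted : ∀ a → Permitted ｛ a ｝
singleton-permitted a = [ s ] , λ { refl → fst s , refl , sym (swap-fst s) }
  where s = swapping (atom (sort a) lower 0) a refl

⇄-fst : ∀ {ν} (a b : 𝔸 ν) → (a ⇄ b) ⟨$⟩ proj₁ a ≡ proj₁ b
⇄-fst (a , p) (b , q) = swap-fst (swapping a b (trans p (sym q)))

⇄-snd : ∀ {ν} (a b : 𝔸 ν) → (a ⇄ b) ⟨$⟩ proj₁ b ≡ proj₁ a
⇄-snd (a , p) (b , q) = swap-snd (swapping a b (trans p (sym q)))

⇄-other : ∀ {ν} (a b : 𝔸 ν) {c} → c ≢ proj₁ a → c ≢ proj₁ b → (a ⇄ b) ⟨$⟩ c ≡ c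
⇄-other (a , p) (b , q) = swap-other (swapping a b (trans p (sym q)))

⇄-cong : ∀ {ν} {a b c d : 𝔸 ν} → proj₁ a ≡ proj₁ c → proj₁ b ≡ proj₁ d → a ⇄ b ≈ₚ c ⇄ d
⇄-cong refl refl _ = refl

⇄-inverse : ∀ {ν} (a b : 𝔸 ν) → (a ⇄ b) ∙ (b ⇄ a) ≈ₚ ε
⇄-inverse a b c with swapped (swapping (proj₁ b) (proj₁ a) (trans (proj₂ b) (sym (proj₂ a)))) c
... | is-fst refl p = trans (cong ((a ⇄ b) ⟨$⟩_) p) (⇄-fst a b)
... | is-snd refl p = trans (cong ((a ⇄ b) ⟨$⟩_) p) (⇄-snd a b)
... | other p q r   = trans (cong ((a ⇄ b) ⟨$⟩_) r) (⇄-other a b q p)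

conj : ∀ {ν} π (a b : 𝔸 ν) → π ∙ (b ⇄ a) ≈ₚ ((π $ₙ b) ⇄ (π $ₙ a)) ∙ π
conj π a b c = trans (⟨$⟩-++ π (b ⇄ a) c) (lemma (swapped s c))
  where
  s = swapping (proj₁ b) (proj₁ a) (trans (proj₂ b) (sym (proj₂ a)))
  s′ = swapping (π ⟨$⟩ proj₁ b) (π ⟨$⟩ proj₁ a) (trans (proj₂ (π $ₙ b)) (sym (proj₂ (π $ₙ a))))
  lemma : Swapped s c → π ⟨$⟩ swap s c ≡ swap s′ (π ⟨$⟩ c)
  lemma (is-fst refl e) = trans (cong (π ⟨$⟩_) e) (sym (swap-fst s′))
  lemma (is-snd refl e) = trans (cong (π ⟨$⟩_) e) (sym (swap-snd s′))
  lemma (other p q e)   = trans (cong (π ⟨$⟩_) e)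
    (sym (swap-other s′ (p ∘ ⟨$⟩-injective π) (q ∘ ⟨$⟩-injective π)))

module ActionSetProperties (X : ActionSet) where
  open ActionSet X

  ·-congʳ : ∀ π {x y} → x ≈ y → π · x ≈ π · y
  ·-congʳ π = ·-cong {π} {π} (λ _ → refl)

  ·-congˡ : ∀ {π ρ} x → π ≈ₚ ρ → π · x ≈ ρ · x
  ·-congˡ x p = ·-cong p ≈-refl

  ·-inverseˡ : ∀ π x → π ⁻¹ · π · x ≈ x
  ·-inverseˡ π x = ≈-trans (≈-sym (·-∙ (π ⁻¹) π x))
    (≈-trans (·-congˡ x (Group.inverseˡ ℙ π)) (·-ε x))

  ·-inverseʳ : ∀ π x → π · π ⁻¹ · x ≈ x
  ·-inverseʳ π x = ≈-trans (≈-sym (·-∙ π (π ⁻¹) x))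
    (≈-trans (·-congˡ x (Group.inverseʳ ℙ π)) (·-ε x))

  ·-injective : ∀ π {x y} → π · x ≈ π · y → x ≈ y
  ·-injective π {x} {y} p =
    ≈-trans (≈-sym (·-inverseˡ π x)) (≈-trans (·-congʳ (π ⁻¹) p) (·-inverseˡ π y))

  Supports-· : ∀ {A x} π → Supports A x → Supports (π ·ˢ A) (π · x)
  Supports-· {A} {x} π A-supp ρ ρ-fix =
    ≈-trans (≈-sym (·-inverseʳ π (ρ · π · x)))
      (·-congʳ π (≈-trans (≈-sym (≈-trans (·-∙ (π ⁻¹) (ρ ∙ π) x) (·-congʳ (π ⁻¹) (·-∙ ρ π x))))
        (A-supp (π ⁻¹ ∙ (ρ ∙ π)) fixes)))
    where
    fixes : (π ⁻¹ ∙ (ρ ∙ π)) ∈ Fix A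
    fixes {a} a∈A = begin
      (π ⁻¹ ∙ (ρ ∙ π)) ⟨$⟩ a    ≡⟨ ⟨$⟩-++ (π ⁻¹) (ρ ∙ π) a ⟩
      π ⁻¹ ⟨$⟩ (ρ ∙ π) ⟨$⟩ a    ≡⟨ cong (π ⁻¹ ⟨$⟩_) (⟨$⟩-++ ρ π a) ⟩
      π ⁻¹ ⟨$⟩ ρ ⟨$⟩ π ⟨$⟩ a    ≡⟨ cong (π ⁻¹ ⟨$⟩_) (ρ-fix (a , a∈A , refl)) ⟩
      π ⁻¹ ⟨$⟩ π ⟨$⟩ a          ≡⟨ reverse-inverseˡ π a ⟩
      a                         ∎
      where open ≡-Reasoning

module PNominalSetProperties (X : PNominalSet) where
  open PNominalSet X
  open ActionSetProperties actionSet public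

  supp-resp : ∀ {x y} → x ≈ y → supp x ⊆ supp y
  supp-resp {x} {y} x≈y = supp-least x (supp y) (supp-permitted y) λ π π-fix →
    ≈-trans (·-congʳ π x≈y) (≈-trans (supp-supports y π π-fix) (≈-sym x≈y))

  supp-·⁻ : ∀ π x → supp (π · x) ⊆ π ·ˢ supp x
  supp-·⁻ π x = supp-least (π · x) (π ·ˢ supp x) (·ˢ-permitted π (supp-permitted x))
    (Supports-· π (supp-supports x))

  supp-·⁺ : ∀ π x {a} → a ∈ supp x → π ⟨$⟩ a ∈ supp (π · x)
  supp-·⁺ π x {a} a∈ with supp-·⁻ (π ⁻¹) (π · x) (supp-resp (≈-sym (·-inverseˡ π x)) a∈)
  ... | b , b∈ , refl = subst (_∈ supp (π · x)) (sym (reverse-inverseʳ π b)) b∈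

  agree : ∀ {π ρ x} → (∀ {a} → a ∈ supp x → π ⟨$⟩ a ≡ ρ ⟨$⟩ a) → π · x ≈ ρ · x
  agree {π} {ρ} {x} p = ≈-trans (≈-sym (·-inverseʳ ρ (π · x)))
    (·-congʳ ρ (≈-trans (≈-sym (·-∙ (ρ ⁻¹) π x))
      (supp-supports x (ρ ⁻¹ ∙ π) λ {a} a∈ → trans (⟨$⟩-++ (ρ ⁻¹) π a)
        (trans (cong (ρ ⁻¹ ⟨$⟩_) (p a∈)) (reverse-inverseˡ ρ a)))))

  freshIndex : Carrier → ℕ
  freshIndex x = bound (mentions (proj₁ (supp-permitted x)))

  freshIndex-∉ : ∀ x {a} → side a ≡ upper → freshIndex x ≤ index a → a ∉ supp x
  freshIndex-∉ x up le a∈ = upper-∉ (proj₁ (supp-permitted x)) up le (proj₂ (supp-permitted x) a∈)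

supp-map : ∀ (X Y : PNominalSet) (F : PNominalSet.actionSet X ⟶ᴱ PNominalSet.actionSet Y) x →
           PNominalSet.supp Y (_⟶ᴱ_.to F x) ⊆ PNominalSet.supp X x
supp-map X Y F x = Y.supp-least (F.to x) (X.supp x) (X.supp-permitted x) λ π π-fix →
  Y.≈-trans (Y.≈-sym (F.equivariant π x)) (F.cong (X.supp-supports x π π-fix))
  where
  module X = PNominalSet X
  module Y = PNominalSet Y
  module F = _⟶ᴱ_ F

𝔸-set : ℕ → ActionSet
𝔸-set ν = record
  { setoid = record
    { Carrier = 𝔸 ν
    ; _≈_     = _≡_ on proj₁
    ; isEquivalence = record { refl = refl ; sym = sym ; trans = trans }
    }
  ; _·_    = _$ₙ_
  ; ·-cong = λ { {π} p refl → p _ }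
  ; ·-ε    = λ _ → refl
  ; ·-∙    = λ π ρ a → ⟨$⟩-++ π ρ (proj₁ a)
  }

∏ : {I : Set} → (I → PNominalSet) → List I → ActionSet
∏ X [] = record
  { setoid = ≡.setoid ⊤
  ; _·_    = λ _ x → x
  ; ·-cong = λ _ p → p
  ; ·-ε    = λ _ → refl
  ; ·-∙    = λ _ _ _ → refl
  }
∏ X (i ∷ is) = record
  { setoid = ×-setoid Xᵢ.setoid Xs.setoid
  ; _·_    = λ { π (x , xs) → π Xᵢ.· x , π Xs.· xs }
  ; ·-cong = λ { p (q , r) → Xᵢ.·-cong p q , Xs.·-cong p r }
  ; ·-ε    = λ { (x , xs) → Xᵢ.·-ε x , Xs.·-ε xs }
  ; ·-∙    = λ { π ρ (x , xs) → Xᵢ.·-∙ π ρ x , Xs.·-∙ π ρ xs }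
  }
  where
  module Xᵢ = PNominalSet (X i)
  module Xs = ActionSet (∏ X is)

-- [a]x is the set 〚 a , x 〛 of pairs.  An element of [𝔸 ν ] X is given by a
-- pair (a , x) denoting that set; equality of elements is equality of sets.

module AtomAbstraction (ν : ℕ) (X : PNominalSet) where
  open PNominalSet X
  open PNominalSetProperties X

  〚_,_〛 : 𝔸 ν → Carrier → Pred (𝔸 ν × Carrier) 0ℓ
  〚 a , x 〛 (b , y) = (proj₁ b ≡ proj₁ a × y ≈ x)
                    ⊎ (proj₁ b ∉ supp x × proj₁ b ≢ proj₁ a × y ≈ (b ⇄ a) · x)

  infix 4 _≈ₐ_

  _≈ₐ_ : 𝔸 ν × Carrier → 𝔸 ν × Carrier → Set
  (a , x) ≈ₐ (b , y) = 〚 a , x 〛 ≐ 〚 b , y 〛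

  private
    self : ∀ (a : 𝔸 ν) x → (a , x) ∈ 〚 a , x 〛
    self a x = inj₁ (refl , ≈-refl)

    ·-⇄-inverse : ∀ (a b : 𝔸 ν) x → (a ⇄ b) · (b ⇄ a) · x ≈ x
    ·-⇄-inverse a b x =
      ≈-trans (≈-sym (·-∙ (a ⇄ b) (b ⇄ a) x)) (≈-trans (·-congˡ x (⇄-inverse a b)) (·-ε x))

    member-⊆ : ∀ (a b : 𝔸 ν) {x y} → (b , y) ∈ 〚 a , x 〛 → 〚 b , y 〛 ⊆ 〚 a , x 〛
    member-⊆ a b (inj₁ (refl , y≈x)) (inj₁ (refl , z≈y)) = inj₁ (refl , ≈-trans z≈y y≈x)
    member-⊆ a b (inj₁ (refl , y≈x)) {c , z} (inj₂ (c∉ , c≢ , z≈)) =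
      inj₂ (c∉ ∘ supp-resp (≈-sym y≈x) , c≢ , ≈-trans z≈ (·-cong (⇄-cong {a = c} {b} {c} {a} refl refl) y≈x))
    member-⊆ a b (inj₂ (b∉ , b≢ , y≈)) {c , z} (inj₁ (refl , z≈y)) =
      inj₂ (b∉ , b≢ , ≈-trans z≈y (≈-trans y≈ (·-congˡ _ (⇄-cong {a = b} {a} {c} {a} refl refl))))
    member-⊆ a b {x} (inj₂ (b∉ , b≢ , y≈)) {c , z} (inj₂ (c∉ , c≢b , z≈)) with proj₁ c ≟ proj₁ a
    ... | yes c≡a = inj₁ (c≡a ,
      ≈-trans z≈ (≈-trans (·-cong (⇄-cong {a = c} {b} {a} {b} c≡a refl) y≈) (·-⇄-inverse a b x)))
    ... | no c≢a = inj₂ (c∉x , c≢a , ≈-trans z≈ (≈-trans (·-congʳ (c ⇄ b) y≈)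
      (≈-trans (≈-sym (·-∙ (c ⇄ b) (b ⇄ a) x)) (agree same))))
      where
      c∉x : proj₁ c ∉ supp x
      c∉x c∈ = c∉ (supp-resp (≈-sym y≈)
        (subst (_∈ supp ((b ⇄ a) · x)) (⇄-other b a c≢b c≢a) (supp-·⁺ (b ⇄ a) x c∈)))
      same : ∀ {d} → d ∈ supp x → ((c ⇄ b) ∙ (b ⇄ a)) ⟨$⟩ d ≡ (c ⇄ a) ⟨$⟩ d
      same {d} d∈ with d ≟ proj₁ a
      ... | yes refl = trans (cong ((c ⇄ b) ⟨$⟩_) (⇄-snd b a)) (trans (⇄-snd c b) (sym (⇄-snd c a)))
      ... | no d≢a = trans (cong ((c ⇄ b) ⟨$⟩_) (⇄-other b a d≢b d≢a))
                       (trans (⇄-other c b d≢c d≢b) (sym (⇄-other c a d≢c d≢a)))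
        where
        d≢b : d ≢ proj₁ b
        d≢b refl = b∉ d∈
        d≢c : d ≢ proj₁ c
        d≢c refl = c∉x d∈

    flip : ∀ (a b : 𝔸 ν) {x y} → (b , y) ∈ 〚 a , x 〛 → (a , x) ∈ 〚 b , y 〛
    flip a b (inj₁ (refl , y≈x)) = inj₁ (refl , ≈-sym y≈x)
    flip a b {x} {y} (inj₂ (b∉ , b≢ , y≈)) =
      inj₂ (a∉y , b≢ ∘ sym , ≈-sym (≈-trans (·-congʳ (a ⇄ b) y≈) (·-⇄-inverse a b x)))
      where
      a∉y : proj₁ a ∉ supp y
      a∉y a∈ with supp-·⁻ (b ⇄ a) x (supp-resp y≈ a∈)
      ... | c , c∈ , a≡ = b∉ (subst (_∈ supp x)
        (⟨$⟩-injective (b ⇄ a) {c} {proj₁ b} (trans (sym a≡) (sym (⇄-fst b a)))) c∈)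

  ∈⇒≈ₐ : ∀ (a b : 𝔸 ν) {x y} → (b , y) ∈ 〚 a , x 〛 → (a , x) ≈ₐ (b , y)
  ∈⇒≈ₐ a b p = member-⊆ b a (flip a b p) , member-⊆ a b p

  ≈ₐ⇒∈ : ∀ (a b : 𝔸 ν) {x y} → (a , x) ≈ₐ (b , y) → (b , y) ∈ 〚 a , x 〛
  ≈ₐ⇒∈ a b {y = y} p = proj₂ p (self b y)

  ∈-equivariant : ∀ π (a b : 𝔸 ν) {x y} → (b , y) ∈ 〚 a , x 〛 → (π $ₙ b , π · y) ∈ 〚 π $ₙ a , π · x 〛
  ∈-equivariant π a b (inj₁ (refl , y≈x)) = inj₁ (refl , ·-congʳ π y≈x)
  ∈-equivariant π a b {x} (inj₂ (b∉ , b≢ , y≈)) =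
    inj₂ (πb∉ , b≢ ∘ ⟨$⟩-injective π , ≈-trans (·-congʳ π y≈)
      (≈-trans (≈-sym (·-∙ π (b ⇄ a) x)) (≈-trans (·-congˡ x (conj π a b)) (·-∙ ((π $ₙ b) ⇄ (π $ₙ a)) π x))))
    where
    πb∉ : proj₁ (π $ₙ b) ∉ supp (π · x)
    πb∉ p with supp-·⁻ π x p
    ... | c , c∈ , e = b∉ (subst (_∈ supp x) (⟨$⟩-injective π {c} {proj₁ b} (sym e)) c∈)

  abstractionSet : ActionSet
  abstractionSet = record
    { setoid = record
      { Carrier = 𝔸 ν × Carrier
      ; _≈_     = _≈ₐ_
      ; isEquivalence = record
        { refl  = (λ p → p) , (λ p → p)
        ; sym   = λ { (p , q) → q , p }
        ; trans = λ { (p , q) (r , s) → (λ t → r (p t)) , (λ t → q (s t)) }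
        }
      }
    ; _·_    = λ { π (a , x) → π $ₙ a , π · x }
    ; ·-cong = λ { {π} {ρ} {a , x} {b , y} π≈ρ p →
        let (q , r)   = ∈⇒≈ₐ (π $ₙ a) (π $ₙ b) (∈-equivariant π a b (≈ₐ⇒∈ a b p))
            (q′ , r′) = ∈⇒≈ₐ (π $ₙ b) (ρ $ₙ b) (inj₁ (sym (π≈ρ _) , ≈-sym (·-congˡ y π≈ρ)))
        in (λ t → q′ (q t)) , (λ t → r (r′ t)) }
    ; ·-ε    = λ { (a , x) → ∈⇒≈ₐ (ε $ₙ a) a (inj₁ (refl , ≈-sym (·-ε x))) }
    ; ·-∙    = λ { π ρ (a , x) →
        ∈⇒≈ₐ ((π ∙ ρ) $ₙ a) (π $ₙ ρ $ₙ a) (inj₁ (sym (⟨$⟩-++ π ρ (proj₁ a)) , ≈-sym (·-∙ π ρ x))) }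
    }

[𝔸_]_ : ℕ → PNominalSet → ActionSet
[𝔸 ν ] X = AtomAbstraction.abstractionSet ν X

data Sort (𝒜 : Pred ℕ 0ℓ) (ℬ : Set) : Set where
  name  : ∀ ν → .(ν ∈ 𝒜) → Sort 𝒜 ℬ
  base  : ℬ → Sort 𝒜 ℬ
  tuple : List (Sort 𝒜 ℬ) → Sort 𝒜 ℬ
  abs   : ∀ ν → .(ν ∈ 𝒜) → Sort 𝒜 ℬ → Sort 𝒜 ℬ

record Signature : Set₁ where
  field
    𝒜        : Pred ℕ 0ℓ
    ℬ        : Set
    Constant : Set
    sortᶜ    : Constant → ℬ
    pmss     : Constant → Pred Atom 0ℓ
    pmss⊆𝔸<  : ∀ C → pmss C ⊆ 𝔸<
    Unknown  : Set
    sortᵘ    : Unknown → Sort 𝒜 ℬ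
    Former   : Set
    domain   : Former → Sort 𝒜 ℬ
    codomain : Former → ℬ

module _ (𝒮 : Signature) where
  open Signature 𝒮

  data Term : Sort 𝒜 ℬ → Set where
    atm : ∀ {ν} .(ν∈𝒜 : ν ∈ 𝒜) → 𝔸 ν → Term (name ν ν∈𝒜)
    con : Permutation → (C : Constant) → Term (base (sortᶜ C))
    unk : Permutation → (X : Unknown) → Term (sortᵘ X)
    app : (f : Former) → Term (domain f) → Term (base (codomain f))
    tup : ∀ {αs} → All Term αs → Term (tuple αs)
    lam : ∀ {ν α} .(ν∈𝒜 : ν ∈ 𝒜) → 𝔸 ν → Term α → Term (abs ν ν∈𝒜 α)

  record Interpretation : Set₁ where
    no-eta-equality
    field
      ⟦_⟧ˢ : Sort 𝒜 ℬ → PNominalSet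

    private
      ⟦_⟧ : Sort 𝒜 ℬ → ActionSet
      ⟦ α ⟧ = PNominalSet.actionSet ⟦ α ⟧ˢ

    field
      atomᴴ   : ∀ {ν} .(ν∈𝒜 : ν ∈ 𝒜) → 𝔸-set ν ↣ᴱ ⟦ name ν ν∈𝒜 ⟧
      absᴴ    : ∀ {ν} .(ν∈𝒜 : ν ∈ 𝒜) α → ([𝔸 ν ] ⟦ α ⟧ˢ) ↣ᴱ ⟦ abs ν ν∈𝒜 α ⟧
      tupleᴴ  : ∀ αs → ∏ ⟦_⟧ˢ αs ↣ᴱ ⟦ tuple αs ⟧
      formerᴴ : ∀ f → ⟦ domain f ⟧ ⟶ᴱ ⟦ base (codomain f) ⟧
      constᴴ  : ∀ C → ∣ ⟦ base (sortᶜ C) ⟧ˢ ∣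
      constᴴ-supp : ∀ C → PNominalSet.supp ⟦ base (sortᶜ C) ⟧ˢ (constᴴ C) ⊆ pmss C

  record Valuation (ℋ : Interpretation) : Set where
    open Interpretation ℋ
    field
      value      : ∀ X → ∣ ⟦ sortᵘ X ⟧ˢ ∣
      value-supp : ∀ X → PNominalSet.supp ⟦ sortᵘ X ⟧ˢ (value X) ⊆ 𝔸<

infixr 6 ⟦_,_⟧_ ⟦_,_⟧*_

mutual
  ⟦_,_⟧_ : ∀ {𝒮 α} (ℋ : Interpretation 𝒮) → Valuation 𝒮 ℋ → Term 𝒮 α →
           ∣ Interpretation.⟦_⟧ˢ ℋ α ∣
  ⟦ ℋ , ς ⟧ atm ν∈𝒜 a = _↣ᴱ_.to (atomᴴ ν∈𝒜) a
    where open Interpretation ℋ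
  ⟦ ℋ , ς ⟧ con π C = PNominalSet._·_ ⟦ _ ⟧ˢ π (constᴴ C)
    where open Interpretation ℋ
  ⟦ ℋ , ς ⟧ unk π X = PNominalSet._·_ ⟦ _ ⟧ˢ π (value X)
    where
    open Interpretation ℋ
    open Valuation ς
  ⟦ ℋ , ς ⟧ app f r = _⟶ᴱ_.to (formerᴴ f) (⟦ ℋ , ς ⟧ r)
    where open Interpretation ℋ
  ⟦ ℋ , ς ⟧ tup rs = _↣ᴱ_.to (tupleᴴ _) (⟦ ℋ , ς ⟧* rs)
    where open Interpretation ℋ
  ⟦ ℋ , ς ⟧ lam ν∈𝒜 a r = _↣ᴱ_.to (absᴴ ν∈𝒜 _) (a , ⟦ ℋ , ς ⟧ r)
    where open Interpretation ℋ

  ⟦_,_⟧*_ : ∀ {𝒮 αs} (ℋ : Interpretation 𝒮) → Valuation 𝒮 ℋ → All (Term 𝒮) αs →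
            ActionSet.Carrier (∏ (Interpretation.⟦_⟧ˢ ℋ) αs)
  ⟦ ℋ , ς ⟧* []       = tt
  ⟦ ℋ , ς ⟧* (r ∷ rs) = ⟦ ℋ , ς ⟧ r , ⟦ ℋ , ς ⟧* rs

-- A cycle (a₁ ⋯ aₙ) is a list of atoms of a common sort; it sends aᵢ to aᵢ₊₁,
-- and aₙ to a₁.

cycle : ∀ {ν} → List (𝔸 ν) → Permutation
cycle []           = ε
cycle (a ∷ [])     = ε
cycle (a ∷ b ∷ bs) = (a ⇄ b) ∙ cycle (b ∷ bs)

moved : Permutation → List Atom
moved π = deduplicate _≟_ (filter (λ a → ¬? (π ⟨$⟩ a ≟ a)) (mentions π))

-- The cycle of π through a: the iterates of π at a up to the first return to a.
-- The length of moved π bounds that of the cycle.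

module _ {ν : ℕ} (π : Permutation) (a : 𝔸 ν) where

  iterates : ℕ → 𝔸 ν → List (𝔸 ν)
  iterates zero    b = []
  iterates (suc n) b = if does (proj₁ b ≟ proj₁ a) then [] else b ∷ iterates n (π $ₙ b)

  cycleThrough : List (𝔸 ν)
  cycleThrough = a ∷ iterates (length (moved π)) (π $ₙ a)

Cycles : Set
Cycles = List (∃ λ ν → List (𝔸 ν))

cyclesThrough : Permutation → List Atom → Cycles
cyclesThrough π []       = []
cyclesThrough π (a ∷ as) =
  let cs = cyclesThrough π as in
  if does (any? (λ (_ , c) → any? (λ b → a ≟ proj₁ b) c) cs)
  then cs
  else (sort a , cycleThrough π (a , refl)) ∷ cs

cycles : Permutation → Cycles
cycles π = cyclesThrough π (moved π)

-- π / S is obtained from the cycles of π by (1) repeatedly deleting an atom that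
-- is outside S together with its predecessor and successor in its cycle (prune);
-- (2) breaking a cycle between a₂ and a₃ wherever it contains consecutive
-- a₁ a₂ a₃ a₄ with a₁, a₄ in S and a₂, a₃ outside S (break).  "Consecutive" is
-- meant cyclically, so that a single break leaves a cycle as it is.  Predecessor
-- and successor in a cycle c are the images under (cycle c)⁻¹ and cycle c.

module _ {S : Pred Atom 0ℓ} (S? : Decidable S) where

  outside : Atom → Bool
  outside a = not (does (S? a))

  module _ {ν : ℕ} where

    deletable : List (𝔸 ν) → 𝔸 ν → Bool
    deletable c (a , _) = outside (cycle c ⁻¹ ⟨$⟩ a) ∧ outside a ∧ outside (cycle c ⟨$⟩ a)

    deleteFirst : (𝔸 ν → Bool) → List (𝔸 ν) → List (𝔸 ν)
    deleteFirst p []       = []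
    deleteFirst p (a ∷ as) = if p a then as else a ∷ deleteFirst p as

    -- A pass without effect means that no deletable atom is left, so length c
    -- passes suffice.
    prune : List (𝔸 ν) → List (𝔸 ν)
    prune c = fold c (λ c′ → deleteFirst (deletable c′) c′) (length c)

    breakAfter : List (𝔸 ν) → 𝔸 ν → Bool
    breakAfter c (a₂ , _) =
      not (outside (cycle c ⁻¹ ⟨$⟩ a₂)) ∧ outside a₂ ∧
      outside (cycle c ⟨$⟩ a₂) ∧ not (outside (cycle c ⟨$⟩ cycle c ⟨$⟩ a₂))

    rotate : (𝔸 ν → Bool) → List (𝔸 ν) → List (𝔸 ν)
    rotate p c = go [] c
      where
      go : List (𝔸 ν) → List (𝔸 ν) → List (𝔸 ν)
      go before []       = before
      go before (a ∷ as) = if p a then as ++ (before ++ [ a ]) else go (before ++ [ a ]) as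

    splitAfter : (𝔸 ν → Bool) → List (𝔸 ν) → List (List (𝔸 ν))
    splitAfter p []       = []
    splitAfter p (a ∷ as) with p a | splitAfter p as
    ... | true  | segments           = [ a ] ∷ segments
    ... | false | []                 = [ a ] ∷ []
    ... | false | segment ∷ segments = (a ∷ segment) ∷ segments

    -- The list is first rotated to end at a break, if there is one, so that no
    -- cycle continues from its end to its start.
    break : List (𝔸 ν) → List (List (𝔸 ν))
    break c = splitAfter (breakAfter c) (rotate (breakAfter c) c)

infix 8 _/_

_/_ : Permutation → {S : Pred Atom 0ℓ} → Decidable S → Permutation
π / S? = concatMap (λ (_ , c) → concatMap cycle (break S? (prune S? c))) (cycles π)

𝔸<? : Decidable 𝔸<
𝔸<? a = side a ≟ₛ lower

module _ (em : ExcludedMiddle 0ℓ) {𝒮 : Signature} where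
  open Signature 𝒮

  mutual
    atoms : ∀ {α} → Term 𝒮 α → Pred Atom 0ℓ
    atoms (atm _ a)   = ｛ proj₁ a ｝
    atoms (con π C)   = nontriv (π / λ a → em {a ∈ pmss C})
    atoms (unk π X)   = nontriv (π / 𝔸<?)
    atoms (app f r)   = atoms r
    atoms (tup rs)    = atoms* rs
    atoms (lam _ a r) = atoms r ∪ ｛ proj₁ a ｝

    atoms* : ∀ {αs} → All (Term 𝒮) αs → Pred Atom 0ℓ
    atoms* []       = ∅
    atoms* (r ∷ rs) = atoms r ∪ atoms* rs

record Enumeration : Set where
  field
    at        : ℕ → Atom
    injective : ∀ {m n} → at m ≡ at n → m ≡ n
    at∈𝔸<     : ∀ n → at n ∈ 𝔸<

-- The metatheory is classical: membership in a list is not decidable in general,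
-- and leastness of supports is proved by contradiction.

module ListAbstraction (em : ExcludedMiddle 0ℓ) (l⋆ : Enumeration) where

  open Enumeration l⋆ using (at; at∈𝔸<)

  stable : {P : Set} → ¬ ¬ P → P
  stable {P} ¬¬p with em {P}
  ... | yes p = p
  ... | no ¬p = contradiction ¬p ¬¬p

  -- π ·l⋆ denotes the list π · l⋆, and l ‼ n is entry n of the list l;
  -- elements are equal when they are the same list.

  record NameList : Set where
    constructor _·l⋆
    field
      perm : Permutation

  open NameList public

  infixl 9 _‼_

  _‼_ : NameList → ℕ → Atom
  l ‼ n = perm l ⟨$⟩ at n

  infix 4 _≈ₗ_

  _≈ₗ_ : NameList → NameList → Set
  l ≈ₗ k = ∀ n → l ‼ n ≡ k ‼ n

  suppₗ : NameList → Pred Atom 0ℓ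
  suppₗ l a = ∃ λ n → l ‼ n ≡ a

  infixr 6 _·ₗ_

  _·ₗ_ : Permutation → NameList → NameList
  π ·ₗ (ρ ·l⋆) = (π ∙ ρ) ·l⋆

  ·ₗ-‼ : ∀ π l n → (π ·ₗ l) ‼ n ≡ π ⟨$⟩ l ‼ n
  ·ₗ-‼ π l n = ⟨$⟩-++ π (perm l) (at n)

  suppₗ-·⁻ : ∀ π l {a} → a ∈ suppₗ (π ·ₗ l) → ∃ λ b → b ∈ suppₗ l × a ≡ π ⟨$⟩ b
  suppₗ-·⁻ π l (n , refl) = l ‼ n , (n , refl) , ·ₗ-‼ π l n

  suppₗ-·⁺ : ∀ π l {a} → a ∈ suppₗ l → π ⟨$⟩ a ∈ suppₗ (π ·ₗ l)
  suppₗ-·⁺ π l (n , refl) = n , ·ₗ-‼ π l n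

  suppₗ-resp : ∀ {l k} → l ≈ₗ k → suppₗ l ⊆ suppₗ k
  suppₗ-resp l≈k (n , e) = n , trans (sym (l≈k n)) e

  suppₗ-permitted : ∀ l → Permitted (suppₗ l)
  suppₗ-permitted l = perm l , λ { (n , e) → at n , at∈𝔸< n , sym e }

  freshIndexₗ : NameList → ℕ
  freshIndexₗ l = bound (mentions (perm l))

  freshIndexₗ-∉ : ∀ l {a} → side a ≡ upper → freshIndexₗ l ≤ index a → a ∉ suppₗ l
  freshIndexₗ-∉ l up le a∈ = upper-∉ (perm l) up le (proj₂ (suppₗ-permitted l) a∈)

  freshIndexₚ : ∀ {A} → Permitted A → ℕ
  freshIndexₚ (π , _) = bound (mentions π)

  freshIndexₚ-∉ : ∀ {A} (p : Permitted A) {a} → side a ≡ upper → freshIndexₚ p ≤ index a → a ∉ A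
  freshIndexₚ-∉ (π , A⊆) up le a∈ = upper-∉ π up le (A⊆ a∈)

  𝕃 : PNominalSet
  𝕃 = record
    { actionSet = record
      { setoid = record
        { Carrier = NameList
        ; _≈_     = _≈ₗ_
        ; isEquivalence = record
          { refl  = λ _ → refl
          ; sym   = λ p n → sym (p n)
          ; trans = λ p q n → trans (p n) (q n)
          }
        }
      ; _·_    = _·ₗ_
      ; ·-cong = λ {π} {ρ} {l} {k} π≈ρ l≈k n →
          trans (·ₗ-‼ π l n) (trans (cong (π ⟨$⟩_) (l≈k n)) (trans (π≈ρ _) (sym (·ₗ-‼ ρ k n))))
      ; ·-ε    = λ _ _ → refl
      ; ·-∙    = λ π ρ l n → Group.assoc ℙ π ρ (perm l) (at n)
      }
    ; supp           = suppₗ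
    ; supp-supports  = λ l π π-fix n → trans (·ₗ-‼ π l n) (π-fix (n , refl))
    ; supp-permitted = suppₗ-permitted
    ; supp-least     = least
    }
    where
    least : ∀ l A → Permitted A → (∀ π → π ∈ Fix A → π ·ₗ l ≈ₗ l) → suppₗ l ⊆ A
    least l A A-perm A-supp {a} (n , l‼n≡a) = stable λ a∉A →
      let s = swapping a (atom (sort a) upper (freshIndexₚ A-perm ⊔ freshIndexₗ l)) refl
          b∉A : snd s ∉ A
          b∉A = freshIndexₚ-∉ A-perm refl (ℕ.m≤m⊔n _ _)
          a≡b = begin
            a                     ≡⟨ sym l‼n≡a ⟩
            l ‼ n                 ≡⟨ sym (A-supp [ s ] (λ { c∈A → swap-other s (λ { refl → a∉A c∈A }) (λ { refl → b∉A c∈A }) }) n) ⟩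
            swap s (l ‼ n)        ≡⟨ cong (swap s) l‼n≡a ⟩
            swap s a              ≡⟨ swap-fst s ⟩
            snd s                 ∎
      in freshIndexₗ-∉ l {snd s} refl (ℕ.m≤n⊔m (freshIndexₚ A-perm) _) (n , trans l‼n≡a a≡b)
        where open ≡-Reasoning

  module 𝕃ₚ = PNominalSetProperties 𝕃

  -- The sets [l]x, and the permissive-nominal set of all of them; as for atoms
  -- above, (l , x) denotes the set 〚 l , x 〛.

  module _ (X : PNominalSet) where
    open PNominalSet X
    open PNominalSetProperties X

    data 〚_,_〛 (l : NameList) (x : Carrier) : Pred (NameList × Carrier) 0ℓ where
      member : ∀ {k y} π → π ∈ Fix (supp x ∖ suppₗ l) → k ≈ₗ π ·ₗ l → y ≈ π · x →
               (k , y) ∈ 〚 l , x 〛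

    private
      member-⊆ : ∀ {l k x y} → (k , y) ∈ 〚 l , x 〛 → 〚 k , y 〛 ⊆ 〚 l , x 〛
      member-⊆ {l} {k} {x} {y} (member π π-fix k≈ y≈) (member {k′} {y′} σ σ-fix k′≈ y′≈) =
        member (σ ∙ π) fixes
          (λ n → trans (k′≈ n) (trans (𝕃ₚ.·-congʳ σ {k} {π ·ₗ l} k≈ n) (sym (PNominalSet.·-∙ 𝕃 σ π l n))))
          (≈-trans y′≈ (≈-trans (·-congʳ σ y≈) (≈-sym (·-∙ σ π x))))
        where
        fixes : (σ ∙ π) ∈ Fix (supp x ∖ suppₗ l)
        fixes {a} (a∈x , a∉l) = trans (⟨$⟩-++ σ π a) (trans (cong (σ ⟨$⟩_) πa≡a) (σ-fix (a∈y , a∉k)))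
          where
          πa≡a : π ⟨$⟩ a ≡ a
          πa≡a = π-fix (a∈x , a∉l)
          a∈y : a ∈ supp y
          a∈y = supp-resp (≈-sym y≈) (subst (_∈ supp (π · x)) πa≡a (supp-·⁺ π x a∈x))
          a∉k : a ∉ suppₗ k
          a∉k a∈k with suppₗ-·⁻ π l (suppₗ-resp {k} {π ·ₗ l} k≈ a∈k)
          ... | b , b∈l , a≡πb = a∉l (subst (_∈ suppₗ l)
                  (⟨$⟩-injective π {b} {a} (trans (sym a≡πb) (sym πa≡a))) b∈l)

      flip : ∀ {l k x y} → (k , y) ∈ 〚 l , x 〛 → (l , x) ∈ 〚 k , y 〛
      flip {l} {k} {x} {y} (member π π-fix k≈ y≈) =
        member (π ⁻¹) fixes
          (λ n → sym (trans (·ₗ-‼ (π ⁻¹) k n) (trans (cong (π ⁻¹ ⟨$⟩_) (trans (k≈ n) (·ₗ-‼ π l n)))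
                   (reverse-inverseˡ π _))))
          (≈-sym (≈-trans (·-congʳ (π ⁻¹) y≈) (·-inverseˡ π x)))
        where
        fixes : (π ⁻¹) ∈ Fix (supp y ∖ suppₗ k)
        fixes {a} (a∈y , a∉k) with supp-·⁻ π x (supp-resp y≈ a∈y)
        ... | b , b∈x , refl = trans (reverse-inverseˡ π b) (sym (π-fix (b∈x , λ b∈l →
                a∉k (suppₗ-resp {π ·ₗ l} {k} (λ n → sym (k≈ n)) (suppₗ-·⁺ π l b∈l)))))

      self : ∀ l x → (l , x) ∈ 〚 l , x 〛
      self l x = member ε (λ _ → refl) (λ _ → refl) (≈-sym (·-ε x))

    _≈[]_ : NameList × Carrier → NameList × Carrier → Set
    (l , x) ≈[] (k , y) = 〚 l , x 〛 ≐ 〚 k , y 〛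

    ∈⇒≈[] : ∀ {l k x y} → (k , y) ∈ 〚 l , x 〛 → (l , x) ≈[] (k , y)
    ∈⇒≈[] p = member-⊆ (flip p) , member-⊆ p

    ≈[]⇒∈ : ∀ {l k x y} → (l , x) ≈[] (k , y) → (k , y) ∈ 〚 l , x 〛
    ≈[]⇒∈ {k = k} {y = y} p = proj₂ p (self k y)

    private
      ≈[]-trans : ∀ {u v w} → u ≈[] v → v ≈[] w → u ≈[] w
      ≈[]-trans (p , q) (r , s) = (λ t → r (p t)) , (λ t → q (s t))

      pointwise : ∀ l k {x y} → l ≈ₗ k → x ≈ y → (l , x) ≈[] (k , y)
      pointwise l k l≈k x≈y =
        ∈⇒≈[] (member ε (λ _ → refl) (λ n → sym (l≈k n)) (≈-trans (≈-sym x≈y) (≈-sym (·-ε _))))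

      ∈-equivariant : ∀ ρ {l k x y} → (k , y) ∈ 〚 l , x 〛 → (ρ ·ₗ k , ρ · y) ∈ 〚 ρ ·ₗ l , ρ · x 〛
      ∈-equivariant ρ {l} {k} {x} {y} (member π π-fix k≈ y≈) = member σ fixes
          (λ n → trans (·ₗ-‼ ρ k n) (trans (cong (ρ ⟨$⟩_) (trans (k≈ n) (·ₗ-‼ π l n)))
                   (sym (trans (·ₗ-‼ σ (ρ ·ₗ l) n) (trans (cong (σ ⟨$⟩_) (·ₗ-‼ ρ l n)) (σρ _))))))
          (≈-trans (·-congʳ ρ y≈) (≈-trans (≈-sym (·-∙ ρ π x))
            (≈-trans (·-congˡ {ρ ∙ π} {σ ∙ ρ} x λ a → trans (⟨$⟩-++ ρ π a) (sym (trans (⟨$⟩-++ σ ρ a) (σρ a))))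
              (·-∙ σ ρ x))))
        where
        σ : Permutation
        σ = ρ ∙ (π ∙ ρ ⁻¹)
        σρ : ∀ a → σ ⟨$⟩ ρ ⟨$⟩ a ≡ ρ ⟨$⟩ π ⟨$⟩ a
        σρ a = trans (⟨$⟩-++ ρ (π ∙ ρ ⁻¹) _) (cong (ρ ⟨$⟩_)
                 (trans (⟨$⟩-++ π (ρ ⁻¹) _) (cong (π ⟨$⟩_) (reverse-inverseˡ ρ a))))
        fixes : σ ∈ Fix (supp (ρ · x) ∖ suppₗ (ρ ·ₗ l))
        fixes (a∈ , a∉) with supp-·⁻ ρ x a∈
        ... | b , b∈x , refl = trans (σρ b) (cong (ρ ⟨$⟩_) (π-fix (b∈x , a∉ ∘ suppₗ-·⁺ ρ l)))

    [𝕃]_ : PNominalSet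
    [𝕃]_ = record
      { actionSet = record
        { setoid = record
          { Carrier = NameList × Carrier
          ; _≈_     = _≈[]_
          ; isEquivalence = record
            { refl  = (λ p → p) , (λ p → p)
            ; sym   = λ { (p , q) → q , p }
            ; trans = ≈[]-trans
            }
          }
        ; _·_    = λ { π (l , x) → π ·ₗ l , π · x }
        ; ·-cong = λ { {π} {ρ} {l , x} {k , y} π≈ρ p →
            ≈[]-trans (∈⇒≈[] (∈-equivariant π (≈[]⇒∈ p)))
              (pointwise (π ·ₗ k) (ρ ·ₗ k) (λ n → trans (·ₗ-‼ π k n) (trans (π≈ρ _) (sym (·ₗ-‼ ρ k n)))) (·-congˡ {π} {ρ} y π≈ρ)) }
        ; ·-ε    = λ { (l , x) → pointwise (ε ·ₗ l) l (λ _ → refl) (·-ε x) }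
        ; ·-∙    = λ { π ρ (l , x) → pointwise ((π ∙ ρ) ·ₗ l) (π ·ₗ ρ ·ₗ l) (PNominalSet.·-∙ 𝕃 π ρ l) (·-∙ π ρ x) }
        }
      ; supp           = λ { (l , x) → supp x ∖ suppₗ l }
      ; supp-supports  = λ { (l , x) π π-fix → ∈⇒≈[] (flip (member π π-fix (λ _ → refl) ≈-refl)) }
      ; supp-permitted = λ { (l , x) → proj₁ (supp-permitted x) , λ { (a∈ , _) → proj₂ (supp-permitted x) a∈ } }
      ; supp-least     = λ { (l , x) → least l x }
      }
      where
      -- If a lies in supp x ∖ suppₗ l but not in A, then swapping a with an atom
      -- b fresh for all data fixes [l]x, and brings b into the support of x.
      least : ∀ l x A → Permitted A → (∀ π → π ∈ Fix A → (π ·ₗ l , π · x) ≈[] (l , x)) →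
              supp x ∖ suppₗ l ⊆ A
      least l x A A-perm A-supp {a} (a∈x , a∉l) = stable impossible
        where
        bounds : ℕ
        bounds = freshIndexₚ A-perm ⊔ (freshIndex x ⊔ freshIndexₗ l)
        s : Swapping
        s = swapping a (atom (sort a) upper bounds) refl
        b∉A : snd s ∉ A
        b∉A = freshIndexₚ-∉ A-perm refl (ℕ.m≤m⊔n _ _)
        b∉x : snd s ∉ supp x
        b∉x = freshIndex-∉ x refl (ℕ.≤-trans (ℕ.m≤m⊔n _ _) (ℕ.m≤n⊔m (freshIndexₚ A-perm) _))
        b∉l : snd s ∉ suppₗ l
        b∉l = freshIndexₗ-∉ l refl (ℕ.≤-trans (ℕ.m≤n⊔m (freshIndex x) _) (ℕ.m≤n⊔m (freshIndexₚ A-perm) _))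
        s-l : ∀ n → swap s (l ‼ n) ≡ l ‼ n
        s-l n = swap-other s (λ e → a∉l (n , e)) (λ e → b∉l (n , e))
        b∈sx : snd s ∈ supp ([ s ] · x)
        b∈sx = subst (_∈ supp ([ s ] · x)) (swap-fst s) (supp-·⁺ [ s ] x a∈x)
        b∉sl : snd s ∉ suppₗ ([ s ] ·ₗ l)
        b∉sl (n , e) = b∉l (n , trans (sym (s-l n)) e)
        impossible : ¬ (a ∉ A)
        impossible a∉A with ≈[]⇒∈ (A-supp [ s ] λ c∈A →
          swap-other s (λ { refl → a∉A c∈A }) (λ { refl → b∉A c∈A }))
        ... | member π π-fix l≈ x≈ = b∉x (supp-resp (≈-sym x≈)
                (subst (_∈ supp (π · [ s ] · x)) (π-fix (b∈sx , b∉sl)) (supp-·⁺ π ([ s ] · x) b∈sx)))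

  private
    -- A permutation taking l to k and fixing every atom that is in neither.  It
    -- is obtained from some permutation taking l to k by composing with (a πa)
    -- for the finitely many moved atoms a outside l and k.
    module _ (l k : NameList) where

      Outside : Pred Atom 0ℓ
      Outside a = a ∉ suppₗ l × a ∉ suppₗ k

      start : Permutation
      start = perm k ∙ perm l ⁻¹

      correct : Atom → Permutation → Permutation
      correct a π with em {Outside a}
      ... | yes _ = [ swapping a (π ⟨$⟩ a) (sym (⟨$⟩-sort π a)) ] ∙ π
      ... | no _  = π

      τ : Permutation
      τ = foldr correct start (mentions start)

      Maps : Pred Permutation 0ℓ
      Maps π = ∀ n → π ⟨$⟩ l ‼ n ≡ k ‼ n

      start-maps : Maps start
      start-maps n = trans (⟨$⟩-++ (perm k) (perm l ⁻¹) _)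
        (cong (perm k ⟨$⟩_) (reverse-inverseˡ (perm l) (at n)))

      correct-maps : ∀ a π → Maps π → Maps (correct a π)
      correct-maps a π π-maps with em {Outside a}
      ... | no _ = π-maps
      ... | yes (a∉l , a∉k) = λ n → trans (swap-other (swapping a (π ⟨$⟩ a) (sym (⟨$⟩-sort π a)))
              (λ e → a∉k (n , trans (sym (π-maps n)) e))
              (λ e → a∉l (n , ⟨$⟩-injective π e)))
            (π-maps n)

      correct-fixed : ∀ a π {c} → Outside c → π ⟨$⟩ c ≡ c → correct a π ⟨$⟩ c ≡ c
      correct-fixed a π {c} out πc≡c with em {Outside a}
      ... | no _ = πc≡c
      ... | yes _ with c ≟ a
      ...   | yes refl = trans (swap-snd s) refl
        where s = swapping a (π ⟨$⟩ a) (sym (⟨$⟩-sort π a))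
      ...   | no c≢a = trans (cong (swap s) πc≡c)
                (swap-other s c≢a (λ e → c≢a (⟨$⟩-injective π (trans πc≡c e))))
        where s = swapping a (π ⟨$⟩ a) (sym (⟨$⟩-sort π a))

      correct-self : ∀ a π → Outside a → correct a π ⟨$⟩ a ≡ a
      correct-self a π out with em {Outside a}
      ... | no ¬out = contradiction out ¬out
      ... | yes _   = swap-snd (swapping a (π ⟨$⟩ a) (sym (⟨$⟩-sort π a)))

      τ-maps : Maps τ
      τ-maps = go (mentions start)
        where
        go : ∀ as → Maps (foldr correct start as)
        go []       = start-maps
        go (a ∷ as) = correct-maps a _ (go as)

      τ-fixes : ∀ {a} → Outside a → τ ⟨$⟩ a ≡ a
      τ-fixes {a} out with any? (a ≟_) (mentions start)
      ... | yes a∈ = go (mentions start) a∈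
        where
        go : ∀ as → a ∈ₗ as → foldr correct start as ⟨$⟩ a ≡ a
        go (b ∷ as) (here refl) = correct-self b _ out
        go (b ∷ as) (there p)   = correct-fixed b _ out (go as p)
      ... | no a∉ = go (mentions start)
        where
        go : ∀ as → foldr correct start as ⟨$⟩ a ≡ a
        go []       = unmentioned-fixed start a∉
        go (b ∷ as) = correct-fixed b _ out (go as)

    module _ (X : PNominalSet) where
      open PNominalSet X
      open PNominalSetProperties X

      -- [l]x = [k]y for some y exactly when the atoms of supp x ∖ suppₗ l are
      -- not in k, and then y can be taken to be τ l k · x
      Movable : NameList → Carrier → NameList → Set
      Movable l x k = supp x ∖ suppₗ l ⊆ ∁ (suppₗ k)

      τ-Fix : ∀ {l x k} → Movable l x k → τ l k ∈ Fix (supp x ∖ suppₗ l)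
      τ-Fix {l} {x} {k} mov a∈ = τ-fixes l k (proj₂ a∈ , mov a∈)

      τ-≈ₗ : ∀ l k → k ≈ₗ τ l k ·ₗ l
      τ-≈ₗ l k n = sym (trans (·ₗ-‼ (τ l k) l n) (τ-maps l k n))

      move-by : ∀ {l x k y} → Movable l x k → y ≈ τ l k · x → PNominalSet._≈_ ([𝕃] X) (l , x) (k , y)
      move-by {l} {x} {k} mov y≈ = ∈⇒≈[] X (member (τ l k) (τ-Fix {l} {x} {k} mov) (τ-≈ₗ l k) y≈)

      move : ∀ {l x k} → Movable l x k → PNominalSet._≈_ ([𝕃] X) (l , x) (k , τ l k · x)
      move mov = move-by mov ≈-refl

      ≈[]⇒Movable : ∀ {l x k y} → PNominalSet._≈_ ([𝕃] X) (l , x) (k , y) → Movable l x k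
      ≈[]⇒Movable {l} {x} {k} {y} e (a∈x , a∉l) (n , kn≡a) with ≈[]⇒∈ X e
      ... | member π π-fix k≈ y≈ = a∉l (n , ⟨$⟩-injective π
              (trans (sym (trans (k≈ n) (·ₗ-‼ π l n))) (trans kn≡a (sym (π-fix (a∈x , a∉l))))))

      ≈[]⇒τ : ∀ {l x k y} → PNominalSet._≈_ ([𝕃] X) (l , x) (k , y) → y ≈ τ l k · x
      ≈[]⇒τ {l} {x} {k} {y} e with ≈[]⇒∈ X e
      ... | member π π-fix k≈ y≈ = ≈-trans y≈ (agree λ {a} a∈ → lemma a a∈)
        where
        lemma : ∀ a → a ∈ supp x → π ⟨$⟩ a ≡ τ l k ⟨$⟩ a
        lemma a a∈ with em {a ∈ suppₗ l}
        ... | yes (n , refl) = trans (sym (trans (k≈ n) (·ₗ-‼ π l n))) (sym (τ-maps l k n))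
        ... | no a∉l = trans (π-fix (a∈ , a∉l)) (sym (τ-Fix {l} {x} {k} (≈[]⇒Movable e) (a∈ , a∉l)))

      ≈[]⇒≈ : ∀ {l x y} → PNominalSet._≈_ ([𝕃] X) (l , x) (l , y) → x ≈ y
      ≈[]⇒≈ {l} {x} {y} e = ≈-sym (≈-trans (≈[]⇒τ e) (≈-trans (agree λ {a} a∈ → lemma a a∈) (·-ε x)))
        where
        lemma : ∀ a → a ∈ supp x → τ l l ⟨$⟩ a ≡ a
        lemma a a∈ with em {a ∈ suppₗ l}
        ... | yes (n , refl) = τ-maps l l n
        ... | no a∉l = τ-fixes l l (a∉l , a∉l)

      ≈⇒≈[] : ∀ l {x y} → x ≈ y → PNominalSet._≈_ ([𝕃] X) (l , x) (l , y)
      ≈⇒≈[] l {x} x≈y = ∈⇒≈[] X (member ε (λ _ → refl) (λ _ → refl)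
        (≈-trans (≈-sym x≈y) (≈-sym (·-ε x))))

    -- l⋆ with the listed atoms replaced by upper atoms of index at least N
    replace : ℕ → List Atom → Permutation
    replace N []       = ε
    replace N (a ∷ as) = [ swapping a (atom (sort a) upper N) refl ] ∙ replace (suc N) as

    freshList : ℕ → List Atom → NameList
    freshList N as = replace N as ·l⋆

    replace-view : ∀ N as {c} → c ∈ 𝔸< → let d = replace N as ⟨$⟩ c in
                   (d ≡ c × c ∉ₗ as) ⊎ (side d ≡ upper × N ≤ index d)
    replace-view N [] c< = inj₁ (refl , λ ())
    replace-view N (a ∷ as) {c} c< = view (swapped s d) (replace-view (suc N) as c<)
      where
      s = swapping a (atom (sort a) upper N) refl
      d = replace (suc N) as ⟨$⟩ c
      view : Swapped s d → (d ≡ c × c ∉ₗ as) ⊎ (side d ≡ upper × suc N ≤ index d) →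
             (swap s d ≡ c × c ∉ₗ a ∷ as) ⊎ (side (swap s d) ≡ upper × N ≤ index (swap s d))
      view (is-fst _ e) _ = inj₂ (cong side e , ℕ.≤-reflexive (sym (cong index e)))
      view (is-snd p e) (inj₁ (q , _)) with () ← trans (sym c<) (cong side (trans (sym q) p))
      view (is-snd p e) (inj₂ (_ , le)) =
        ⊥-elim (ℕ.<-irrefl refl (ℕ.≤-trans le (ℕ.≤-reflexive (cong index p))))
      view (other p q e) (inj₁ (r , c∉)) =
        inj₁ (trans e r , λ { (here c≡a) → p (trans r c≡a) ; (there c∈) → c∉ c∈ })
      view (other p q e) (inj₂ (up , le)) =
        inj₂ (trans (cong side e) up , ℕ.≤-trans (ℕ.<⇒≤ le) (ℕ.≤-reflexive (sym (cong index e))))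

    freshList-∈ : ∀ N as {a} → a ∈ suppₗ (freshList N as) →
                  ((∃ λ n → at n ≡ a) × a ∉ₗ as) ⊎ (side a ≡ upper × N ≤ index a)
    freshList-∈ N as (n , refl) with replace-view N as (at∈𝔸< n)
    ... | inj₁ (e , at∉) = inj₁ ((n , sym e) , λ p → at∉ (subst (_∈ₗ as) e p))
    ... | inj₂ q         = inj₂ q

    freshList-avoids : ∀ N as {a} → a ∈ₗ as → bound as ≤ N → a ∉ suppₗ (freshList N as)
    freshList-avoids N as a∈ le p with freshList-∈ N as p
    ... | inj₁ (_ , a∉)  = a∉ a∈
    ... | inj₂ (_ , le′) = bound-∉ as (ℕ.≤-trans le le′) a∈

    freshList-Movable : ∀ X N as l x → (∀ {a} → a ∈ₗ mentions (perm l) → a ∈ₗ as) →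
      PNominalSetProperties.freshIndex X x ≤ N → Movable X l x (freshList N as)
    freshList-Movable X N as l x sub le {a} (a∈x , a∉l) p with freshList-∈ N as p
    ... | inj₁ ((n , refl) , a∉) = a∉l (n , unmentioned-fixed (perm l) (a∉ ∘ sub))
    ... | inj₂ (up , le′) = PNominalSetProperties.freshIndex-∉ X x up (ℕ.≤-trans le le′) a∈x

  -- Each operation of [m]ℋ picks a representative; the equation proved with it
  -- holds for all representatives.

  module Former (X Y : PNominalSet) (F : PNominalSet.actionSet X ⟶ᴱ PNominalSet.actionSet Y) where
    private
      module X = PNominalSet X
      module Y = PNominalSet Y
      module LY = PNominalSet ([𝕃] Y)
      module F = _⟶ᴱ_ F

    former : PNominalSet.actionSet ([𝕃] X) ⟶ᴱ PNominalSet.actionSet ([𝕃] Y)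
    former = record
      { func = record
        { to   = λ { (l , x) → l , F.to x }
        ; cong = λ e → ∈⇒≈[] Y (resp (≈[]⇒∈ X e))
        }
      ; equivariant = λ { π (l , x) → ≈⇒≈[] Y (π ·ₗ l) (F.equivariant π x) }
      }
      where
      resp : ∀ {l k x y} → 〚_,_〛 X l x (k , y) → 〚_,_〛 Y l (F.to x) (k , F.to y)
      resp {x = x} (member π π-fix k≈ y≈) = member π
        (λ { (a∈ , a∉) → π-fix (supp-map X Y F x a∈ , a∉) }) k≈
        (Y.≈-trans (F.cong y≈) (F.equivariant π x))

  module AtomMap {ν : ℕ} (X : PNominalSet) (F : 𝔸-set ν ↣ᴱ PNominalSet.actionSet X) where
    private
      module X = PNominalSet X
      module XP = PNominalSetProperties X
      module LX = PNominalSet ([𝕃] X)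
      module F = _↣ᴱ_ F

      listFor : 𝔸 ν → NameList
      listFor (a , _) = freshList (bound [ a ]) [ a ]

      listFor-∌ : ∀ a → proj₁ a ∉ suppₗ (listFor a)
      listFor-∌ (a , _) = freshList-avoids (bound [ a ]) [ a ] (here refl) ℕ.≤-refl

      fixes : ∀ π a → π ⟨$⟩ proj₁ a ≡ proj₁ a → π X.· F.to a X.≈ F.to a
      fixes π a p = X.≈-trans (X.≈-sym (F.equivariant π a)) (F.cong p)

      supp⁻ : ∀ a → X.supp (F.to a) ⊆ ｛ proj₁ a ｝
      supp⁻ a = X.supp-least (F.to a) ｛ proj₁ a ｝ (singleton-permitted (proj₁ a))
        λ π π-fix → fixes π a (π-fix refl)

      supp⁺ : ∀ a → proj₁ a ∈ X.supp (F.to a)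
      supp⁺ (a , a∈ν) = stable λ a∉ →
        let N = XP.freshIndex (F.to (a , a∈ν)) ⊔ suc (index a)
            s = swapping a (atom (sort a) upper N) refl
            b∉ = XP.freshIndex-∉ (F.to (a , a∈ν)) {snd s} refl (ℕ.m≤m⊔n _ _)
            sa≈a = X.supp-supports (F.to (a , a∈ν)) [ s ] λ c∈ →
              swap-other s (λ { refl → a∉ c∈ }) (λ { refl → b∉ c∈ })
            b≡a = trans (sym (swap-fst s)) (F.injective
              (X.≈-trans (F.equivariant [ s ] (a , a∈ν)) sa≈a))
        in ℕ.<-irrefl refl (ℕ.≤-trans (ℕ.m≤n⊔m (XP.freshIndex (F.to (a , a∈ν))) (suc (index a)))
             (ℕ.≤-reflexive (cong index b≡a)))

      same : ∀ a {l k} → proj₁ a ∉ suppₗ l → proj₁ a ∉ suppₗ k → (l , F.to a) LX.≈ (k , F.to a)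
      same a {l} {k} a∉l a∉k = move-by X mov (X.≈-sym (fixes (τ l k) a (τ-fixes l k (a∉l , a∉k))))
        where
        mov : Movable X l (F.to a) k
        mov (c∈ , _) with refl ← supp⁻ a c∈ = a∉k

    atomMap : 𝔸-set ν ↣ᴱ PNominalSet.actionSet ([𝕃] X)
    atomMap = record
      { injection = record
        { to        = λ a → listFor a , F.to a
        ; cong      = λ { {a} {b} refl → ≈⇒≈[] X (listFor a) (F.cong refl) }
        ; injective = λ {a} {b} e → inj a b (≈[]⇒∈ X e)
        }
      ; equivariant = λ π a → LX.≈-trans
          (same (π $ₙ a) {k = π ·ₗ listFor a} (listFor-∌ (π $ₙ a)) (λ p → lemma π a (suppₗ-·⁻ π (listFor a) p)))
          (≈⇒≈[] X (π ·ₗ listFor a) (F.equivariant π a))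
      }
      where
      lemma : ∀ π a → ¬ (∃ λ b → b ∈ suppₗ (listFor a) × π ⟨$⟩ proj₁ a ≡ π ⟨$⟩ b)
      lemma π a (b , b∈ , e) =
        listFor-∌ a (subst (_∈ suppₗ (listFor a)) (sym (⟨$⟩-injective π {proj₁ a} {b} e)) b∈)
      inj : ∀ a b → 〚_,_〛 X (listFor a) (F.to a) (listFor b , F.to b) → proj₁ a ≡ proj₁ b
      inj a b (member π π-fix k≈ y≈) = sym (trans
        (F.injective (X.≈-trans y≈ (X.≈-sym (F.equivariant π a))))
        (π-fix (supp⁺ a , listFor-∌ a)))

    atomMap-≈ : ∀ {l} a → proj₁ a ∉ suppₗ l → _↣ᴱ_.to atomMap a LX.≈ (l , F.to a)
    atomMap-≈ a a∉l = same a (listFor-∌ a) a∉l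

  -- the tuple ([l]x₁ , … , [l]xₙ)
  over : {I : Set} (X : I → PNominalSet) (is : List I) → NameList →
         ActionSet.Carrier (∏ X is) → ActionSet.Carrier (∏ (λ i → [𝕃] X i) is)
  over X []       l _        = tt
  over X (i ∷ is) l (x , xs) = (l , x) , over X is l xs

  module TupleMap {I : Set} (X : I → PNominalSet) (is : List I) (Y : PNominalSet)
                  (F : ∏ X is ↣ᴱ PNominalSet.actionSet Y) where
    private
      module Y = PNominalSet Y
      module YP = PNominalSetProperties Y
      module LY = PNominalSet ([𝕃] Y)
      module F = _↣ᴱ_ F

      LX : I → PNominalSet
      LX i = [𝕃] X i

      C LC : List I → Set
      C js  = ActionSet.Carrier (∏ X js)
      LC js = ActionSet.Carrier (∏ LX js)

      mentioned : ∀ js → LC js → List Atom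
      mentioned []       _              = []
      mentioned (j ∷ js) ((l , _) , xs) = mentions (perm l) ++ mentioned js xs

      indices : ∀ js → LC js → ℕ
      indices []       _              = 0
      indices (j ∷ js) ((_ , x) , xs) = PNominalSetProperties.freshIndex (X j) x ⊔ indices js xs

      common : ∀ js → LC js → NameList
      common js xs = freshList (indices js xs) (mentioned js xs)

      align : ∀ js → NameList → LC js → C js
      align []       k _              = tt
      align (j ∷ js) k ((l , x) , xs) = PNominalSet._·_ (X j) (τ l k) x , align js k xs

      module ∏X (js : List I) = ActionSet (∏ X js)
      module ∏LX (js : List I) = ActionSet (∏ LX js)

      align-≈ : ∀ js xs N as → (∀ {a} → a ∈ₗ mentioned js xs → a ∈ₗ as) → indices js xs ≤ N →
        let k = freshList N as in ∏LX._≈_ js xs (over X js k (align js k xs))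
      align-≈ [] _ N as _ _ = refl
      align-≈ (j ∷ js) ((l , x) , xs) N as sub le =
        move (X j) {l} {x} {freshList N as}
          (freshList-Movable (X j) N as l x (sub ∘ ∈-++⁺ˡ)
            (ℕ.≤-trans (ℕ.m≤m⊔n (PNominalSetProperties.freshIndex (X j) x) (indices js xs)) le)) ,
        align-≈ js xs N as (sub ∘ ∈-++⁺ʳ (mentions (perm l)))
          (ℕ.≤-trans (ℕ.m≤n⊔m (PNominalSetProperties.freshIndex (X j) x) (indices js xs)) le)

      common-≈ : ∀ js xs → ∏LX._≈_ js xs (over X js (common js xs) (align js (common js xs) xs))
      common-≈ js xs = align-≈ js xs _ _ (λ p → p) ℕ.≤-refl

      supps : ∀ js → C js → Pred Atom 0ℓ
      supps []       _        = ∅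
      supps (j ∷ js) (x , xs) = PNominalSet.supp (X j) x ∪ supps js xs

      supps-supports : ∀ js xs π → π ∈ Fix (supps js xs) → ∏X._≈_ js (∏X._·_ js π xs) xs
      supps-supports []       _        π π-fix = refl
      supps-supports (j ∷ js) (x , xs) π π-fix =
        PNominalSet.supp-supports (X j) x π (π-fix ∘ inj₁) , supps-supports js xs π (π-fix ∘ inj₂)

      supps-least : ∀ js xs A → Permitted A →
        (∀ π → π ∈ Fix A → ∏X._≈_ js (∏X._·_ js π xs) xs) → supps js xs ⊆ A
      supps-least (j ∷ js) (x , xs) A A-perm A-supp (inj₁ a∈) =
        PNominalSet.supp-least (X j) x A A-perm (λ π π-fix → proj₁ (A-supp π π-fix)) a∈
      supps-least (j ∷ js) (x , xs) A A-perm A-supp (inj₂ a∈) =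
        supps-least js xs A A-perm (λ π π-fix → proj₂ (A-supp π π-fix)) a∈

      supp⁺ : ∀ xs → supps is xs ⊆ Y.supp (F.to xs)
      supp⁺ xs = supps-least is xs (Y.supp (F.to xs)) (Y.supp-permitted (F.to xs)) λ π π-fix →
        F.injective (Y.≈-trans (F.equivariant π xs) (Y.supp-supports (F.to xs) π π-fix))

      supp⁻ : ∀ xs → Y.supp (F.to xs) ⊆ supps is xs
      supp⁻ xs = Y.supp-least (F.to xs) (supps is xs)
        (proj₁ (Y.supp-permitted (F.to xs)) , λ a∈ → proj₂ (Y.supp-permitted (F.to xs)) (supp⁺ xs a∈))
        λ π π-fix → Y.≈-trans (Y.≈-sym (F.equivariant π xs)) (F.cong (supps-supports is xs π π-fix))

      over-·⁻ : ∀ js {l k} xs ys → ∏LX._≈_ js (over X js l xs) (over X js k ys) →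
        (supps js xs ∖ suppₗ l ⊆ ∁ (suppₗ k)) × ∏X._≈_ js ys (∏X._·_ js (τ l k) xs)
      over-·⁻ [] _ _ _ = (λ { (() , _) }) , refl
      over-·⁻ (j ∷ js) {l} {k} (x , xs) (y , ys) (e , es) with over-·⁻ js xs ys es
      ... | mov , eq = (λ { (inj₁ a∈ , a∉) → ≈[]⇒Movable (X j) e (a∈ , a∉)
                          ; (inj₂ a∈ , a∉) → mov (a∈ , a∉) })
                     , (≈[]⇒τ (X j) e , eq)

      over-·⁺ : ∀ js {l k} xs ys → supps js xs ∖ suppₗ l ⊆ ∁ (suppₗ k) →
        ∏X._≈_ js ys (∏X._·_ js (τ l k) xs) → ∏LX._≈_ js (over X js l xs) (over X js k ys)
      over-·⁺ [] _ _ _ _ = refl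
      over-·⁺ (j ∷ js) {l} {k} (x , xs) (y , ys) mov (e , es) =
        move-by (X j) (λ { (a∈ , a∉) → mov (inj₁ a∈ , a∉) }) e ,
        over-·⁺ js xs ys (λ { (a∈ , a∉) → mov (inj₂ a∈ , a∉) }) es

      over-equivariant : ∀ js π l xs →
        ∏LX._≈_ js (∏LX._·_ js π (over X js l xs)) (over X js (π ·ₗ l) (∏X._·_ js π xs))
      over-equivariant []       π l _        = refl
      over-equivariant (j ∷ js) π l (x , xs) =
        ≈⇒≈[] (X j) (π ·ₗ l) (PNominalSet.≈-refl (X j)) , over-equivariant js π l xs

      over-cong : ∀ {l k} xs ys → ∏LX._≈_ is (over X is l xs) (over X is k ys) →
        (l , F.to xs) LY.≈ (k , F.to ys)
      over-cong {l} {k} xs ys e with over-·⁻ is xs ys e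
      ... | mov , ys≈ = move-by Y (λ { (a∈ , a∉) → mov (supp⁻ xs a∈ , a∉) })
              (Y.≈-trans (F.cong ys≈) (F.equivariant (τ l k) xs))

      over-injective : ∀ {l k} xs ys → (l , F.to xs) LY.≈ (k , F.to ys) →
        ∏LX._≈_ is (over X is l xs) (over X is k ys)
      over-injective {l} {k} xs ys e = over-·⁺ is xs ys
        (λ { (a∈ , a∉) → ≈[]⇒Movable Y e (supp⁺ xs a∈ , a∉) })
        (F.injective (Y.≈-trans (≈[]⇒τ Y e) (Y.≈-sym (F.equivariant (τ l k) xs))))

    tupleMap : ∏ LX is ↣ᴱ PNominalSet.actionSet ([𝕃] Y)
    tupleMap = record
      { injection = record
        { to        = to
        ; cong      = λ {xs} {ys} e → over-cong _ _
            (P.≈-trans (P.≈-sym (common-≈ is xs)) (P.≈-trans e (common-≈ is ys)))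
        ; injective = λ {xs} {ys} e → P.≈-trans (common-≈ is xs)
            (P.≈-trans (over-injective _ _ e) (P.≈-sym (common-≈ is ys)))
        }
      ; equivariant = λ π xs → LY.≈-trans
          (over-cong _ (∏X._·_ is π (align is (common is xs) xs))
            (P.≈-trans (P.≈-sym (common-≈ is (π P.· xs)))
              (P.≈-trans (ActionSetProperties.·-congʳ (∏ LX is) π (common-≈ is xs))
                (over-equivariant is π (common is xs) _))))
          (≈⇒≈[] Y (π ·ₗ common is xs) (F.equivariant π _))
      }
      where
      module P = ∏LX is
      to : LC is → LY.Carrier
      to xs = common is xs , F.to (align is (common is xs) xs)

    tupleMap-≈ : ∀ l xs → _↣ᴱ_.to tupleMap (over X is l xs) LY.≈ (l , F.to xs)
    tupleMap-≈ l xs = over-cong _ xs (∏LX.≈-sym is (common-≈ is (over X is l xs)))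

  module AbstractionMap {ν : ℕ} (X Y : PNominalSet) (F : ([𝔸 ν ] X) ↣ᴱ PNominalSet.actionSet Y) where
    private
      module X = PNominalSet X
      module XP = PNominalSetProperties X
      module Y = PNominalSet Y
      module LX = PNominalSet ([𝕃] X)
      module LY = PNominalSet ([𝕃] Y)
      module A = AtomAbstraction ν X
      module LA = AtomAbstraction ν ([𝕃] X)
      module ALX = ActionSet ([𝔸 ν ] ([𝕃] X))
      module F = _↣ᴱ_ F

      -- a list avoiding the atoms bs, to which both (l , x) and (k , y) can be moved
      avoid : List Atom → NameList × X.Carrier → NameList × X.Carrier → NameList
      avoid bs (l , x) (k , y) = freshList (bound as ⊔ (XP.freshIndex x ⊔ XP.freshIndex y)) as
        where as = bs ++ (mentions (perm l) ++ mentions (perm k))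

      avoid-∌ : ∀ bs u v {b} → b ∈ₗ bs → b ∉ suppₗ (avoid bs u v)
      avoid-∌ bs (l , x) (k , y) b∈ = freshList-avoids _ _ (∈-++⁺ˡ b∈) (ℕ.m≤m⊔n _ _)

      avoid-Movableˡ : ∀ bs l x v → Movable X l x (avoid bs (l , x) v)
      avoid-Movableˡ bs l x (k , y) = freshList-Movable X _ _ l x (∈-++⁺ʳ bs ∘ ∈-++⁺ˡ)
        (ℕ.≤-trans (ℕ.m≤m⊔n _ (XP.freshIndex y)) (ℕ.m≤n⊔m (bound as) _))
        where as = bs ++ (mentions (perm l) ++ mentions (perm k))

      avoid-Movableʳ : ∀ bs u k y → Movable X k y (avoid bs u (k , y))
      avoid-Movableʳ bs (l , x) k y = freshList-Movable X _ _ k y (∈-++⁺ʳ bs ∘ ∈-++⁺ʳ (mentions (perm l)))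
        (ℕ.≤-trans (ℕ.m≤n⊔m (XP.freshIndex x) _) (ℕ.m≤n⊔m (bound as) _))
        where as = bs ++ (mentions (perm l) ++ mentions (perm k))

      F-cong-∈ : ∀ a b {x y} → (b , y) ∈ A.〚 a , x 〛 → F.to (a , x) Y.≈ F.to (b , y)
      F-cong-∈ a b p = F.cong (A.∈⇒≈ₐ a b p)

      supp⁻ : ∀ a x → Y.supp (F.to (a , x)) ⊆ X.supp x
      supp⁻ a x p = proj₁ (Y.supp-least (F.to (a , x)) (X.supp x ∖ ｛ proj₁ a ｝)
          (proj₁ (X.supp-permitted x) , λ { (c∈ , _) → proj₂ (X.supp-permitted x) c∈ })
          (λ π π-fix → Y.≈-trans (Y.≈-sym (F.equivariant π (a , x))) (Y.≈-sym (F-cong-∈ a (π $ₙ a) (moved-∈ π π-fix))))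
          p)
        where
        moved-∈ : ∀ π → π ∈ Fix (X.supp x ∖ ｛ proj₁ a ｝) → (π $ₙ a , π X.· x) ∈ A.〚 a , x 〛
        moved-∈ π π-fix with π ⟨$⟩ proj₁ a ≟ proj₁ a
        ... | yes πa≡a = inj₁ (πa≡a , X.≈-trans (XP.agree λ {c} c∈ → same c c∈) (X.·-ε x))
          where
          same : ∀ c → c ∈ X.supp x → π ⟨$⟩ c ≡ c
          same c c∈ with proj₁ a ≟ c
          ... | yes refl = πa≡a
          ... | no a≢c   = π-fix (c∈ , a≢c)
        ... | no πa≢a = inj₂ (πa∉ , πa≢a , XP.agree λ {c} c∈ → same c c∈)
          where
          πa∉ : π ⟨$⟩ proj₁ a ∉ X.supp x
          πa∉ πa∈ = πa≢a (⟨$⟩-injective π (π-fix (πa∈ , πa≢a ∘ sym)))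
          same : ∀ c → c ∈ X.supp x → π ⟨$⟩ c ≡ ((π $ₙ a) ⇄ a) ⟨$⟩ c
          same c c∈ with proj₁ a ≟ c
          ... | yes refl = sym (⇄-snd (π $ₙ a) a)
          ... | no a≢c   = trans (π-fix (c∈ , a≢c))
                  (sym (⇄-other (π $ₙ a) a (λ { refl → πa∉ c∈ }) (a≢c ∘ sym)))

      inner : ∀ a {l k x y} → proj₁ a ∉ suppₗ l → proj₁ a ∉ suppₗ k → (l , x) LX.≈ (k , y) →
        (l , F.to (a , x)) LY.≈ (k , F.to (a , y))
      inner a {l} {k} {x} {y} a∉l a∉k e = move-by Y
        (λ { (c∈ , c∉) → ≈[]⇒Movable X e (supp⁻ a x c∈ , c∉) })
        (Y.≈-trans (F-cong-∈ a (τ l k $ₙ a)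
            (inj₁ (τ-fixes l k (a∉l , a∉k) , X.≈-sym (≈[]⇒τ X e))))
          (F.equivariant (τ l k) (a , x)))

      ⇄-list : ∀ (a b : 𝔸 ν) l x → proj₁ a ∉ suppₗ l → proj₁ b ∉ suppₗ l →
        ((b ⇄ a) ·ₗ l , (b ⇄ a) X.· x) LX.≈ (l , (b ⇄ a) X.· x)
      ⇄-list a b l x a∉ b∉ = ∈⇒≈[] X (member ε (λ _ → refl)
        (λ n → sym (trans (·ₗ-‼ (b ⇄ a) l n)
          (⇄-other b a (λ e → b∉ (n , e)) (λ e → a∉ (n , e)))))
        (X.≈-sym (X.·-ε _)))

      common⁻ : ∀ a b l {x y} → proj₁ a ∉ suppₗ l → proj₁ b ∉ suppₗ l →
        (b , (l , y)) ∈ LA.〚 a , (l , x) 〛 → (b , y) ∈ A.〚 a , x 〛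
      common⁻ a b l a∉ b∉ (inj₁ (b≡a , e)) = inj₁ (b≡a , ≈[]⇒≈ X e)
      common⁻ a b l {x} a∉ b∉ (inj₂ (b∉x , b≢a , e)) =
        inj₂ ((λ b∈ → b∉x (b∈ , b∉)) , b≢a , ≈[]⇒≈ X (LX.≈-trans e (⇄-list a b l x a∉ b∉)))

      common⁺ : ∀ a b l {x y} → proj₁ a ∉ suppₗ l → proj₁ b ∉ suppₗ l →
        (b , y) ∈ A.〚 a , x 〛 → (b , (l , y)) ∈ LA.〚 a , (l , x) 〛
      common⁺ a b l a∉ b∉ (inj₁ (b≡a , e)) = inj₁ (b≡a , ≈⇒≈[] X l e)
      common⁺ a b l {x} a∉ b∉ (inj₂ (b∉x , b≢a , e)) =
        inj₂ (b∉x ∘ proj₁ , b≢a , LX.≈-trans (≈⇒≈[] X l e) (LX.≈-sym (⇄-list a b l x a∉ b∉)))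

      module _ (a b : 𝔸 ν) {l k : NameList} {x y : X.Carrier} (a∉l : proj₁ a ∉ suppₗ l) (b∉k : proj₁ b ∉ suppₗ k) where
        j : NameList
        j = avoid (proj₁ a ∷ proj₁ b ∷ []) (l , x) (k , y)
        a∉j : proj₁ a ∉ suppₗ j
        a∉j = avoid-∌ (proj₁ a ∷ proj₁ b ∷ []) (l , x) (k , y) (here refl)
        b∉j : proj₁ b ∉ suppₗ j
        b∉j = avoid-∌ (proj₁ a ∷ proj₁ b ∷ []) (l , x) (k , y) (there (here refl))
        x≈ : (l , x) LX.≈ (j , τ l j X.· x)
        x≈ = move X (avoid-Movableˡ (proj₁ a ∷ proj₁ b ∷ []) l x (k , y))
        y≈ : (k , y) LX.≈ (j , τ k j X.· y)
        y≈ = move X (avoid-Movableʳ (proj₁ a ∷ proj₁ b ∷ []) (l , x) k y)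

        outer-x : (a , (l , x)) ALX.≈ (a , (j , τ l j X.· x))
        outer-x = LA.∈⇒≈ₐ a a (inj₁ (refl , LX.≈-sym x≈))
        outer-y : (b , (k , y)) ALX.≈ (b , (j , τ k j X.· y))
        outer-y = LA.∈⇒≈ₐ b b (inj₁ (refl , LX.≈-sym y≈))

        resp : (a , (l , x)) ALX.≈ (b , (k , y)) → (l , F.to (a , x)) LY.≈ (k , F.to (b , y))
        resp e = LY.≈-trans (inner a a∉l a∉j x≈) (LY.≈-trans
          (≈⇒≈[] Y j (F-cong-∈ a b (common⁻ a b j a∉j b∉j (LA.≈ₐ⇒∈ a b
            (ALX.≈-trans (ALX.≈-sym outer-x) (ALX.≈-trans e outer-y))))))
          (LY.≈-sym (inner b b∉k b∉j y≈)))

        reflects : (l , F.to (a , x)) LY.≈ (k , F.to (b , y)) → (a , (l , x)) ALX.≈ (b , (k , y))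
        reflects e = ALX.≈-trans outer-x (ALX.≈-trans
          (LA.∈⇒≈ₐ a b (common⁺ a b j a∉j b∉j (A.≈ₐ⇒∈ a b (F.injective (≈[]⇒≈ Y
            (LY.≈-trans (LY.≈-sym (inner a a∉l a∉j x≈)) (LY.≈-trans e (inner b b∉k b∉j y≈))))))))
          (ALX.≈-sym outer-y))

      listFor : 𝔸 ν × LX.Carrier → NameList
      listFor (a , u) = avoid [ proj₁ a ] u u

      listFor-∌ : ∀ a u → proj₁ a ∉ suppₗ (listFor (a , u))
      listFor-∌ a u = avoid-∌ [ proj₁ a ] u u (here refl)

      elementFor : 𝔸 ν × LX.Carrier → X.Carrier
      elementFor (a , (l , x)) = τ l (listFor (a , (l , x))) X.· x

      for-≈ : ∀ a u → (a , u) ALX.≈ (a , (listFor (a , u) , elementFor (a , u)))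
      for-≈ a (l , x) = LA.∈⇒≈ₐ a a (inj₁ (refl ,
        LX.≈-sym (move X (avoid-Movableˡ [ proj₁ a ] l x (l , x)))))

    abstractionMap : ([𝔸 ν ] ([𝕃] X)) ↣ᴱ PNominalSet.actionSet ([𝕃] Y)
    abstractionMap = record
      { injection = record
        { to        = to
        ; cong      = λ { {a , u} {b , v} e → resp a b (listFor-∌ a u) (listFor-∌ b v)
            (ALX.≈-trans (ALX.≈-sym (for-≈ a u)) (ALX.≈-trans e (for-≈ b v))) }
        ; injective = λ { {a , u} {b , v} e → ALX.≈-trans (for-≈ a u)
            (ALX.≈-trans (reflects a b (listFor-∌ a u) (listFor-∌ b v) e) (ALX.≈-sym (for-≈ b v))) }
        }
      ; equivariant = λ { π (a , u) → LY.≈-trans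
          (resp (π $ₙ a) (π $ₙ a) (listFor-∌ (π $ₙ a) (π LX.· u)) (πa∉ π a u)
            (ALX.≈-trans (ALX.≈-sym (for-≈ (π $ₙ a) (π LX.· u)))
              (ActionSetProperties.·-congʳ ([𝔸 ν ] ([𝕃] X)) π (for-≈ a u))))
          (≈⇒≈[] Y (π ·ₗ listFor (a , u)) (F.equivariant π (a , elementFor (a , u)))) }
      }
      where
      to : 𝔸 ν × LX.Carrier → LY.Carrier
      to (a , u) = listFor (a , u) , F.to (a , elementFor (a , u))
      πa∉ : ∀ π a u → π ⟨$⟩ proj₁ a ∉ suppₗ (π ·ₗ listFor (a , u))
      πa∉ π a u p with suppₗ-·⁻ π (listFor (a , u)) p
      ... | b , b∈ , e =
        listFor-∌ a u (subst (_∈ suppₗ (listFor (a , u))) (sym (⟨$⟩-injective π {proj₁ a} {b} e)) b∈)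

    abstractionMap-≈ : ∀ a {l} x → proj₁ a ∉ suppₗ l →
      _↣ᴱ_.to abstractionMap (a , (l , x)) LY.≈ (l , F.to (a , x))
    abstractionMap-≈ a {l} x a∉l =
      resp a a (listFor-∌ a (l , x)) a∉l (ALX.≈-sym (for-≈ a (l , x)))

  infixr 8 [_]ᴵ_ [_]ⱽ_

  [_]ᴵ_ : ∀ {𝒮} → NameList → Interpretation 𝒮 → Interpretation 𝒮
  Interpretation.⟦_⟧ˢ ([ m ]ᴵ ℋ) α = [𝕃] ⟦ α ⟧ˢ
    where open Interpretation ℋ
  Interpretation.atomᴴ ([ m ]ᴵ ℋ) ν∈𝒜 = AtomMap.atomMap ⟦ name _ ν∈𝒜 ⟧ˢ (atomᴴ ν∈𝒜)
    where open Interpretation ℋ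
  Interpretation.absᴴ ([ m ]ᴵ ℋ) ν∈𝒜 α =
    AbstractionMap.abstractionMap ⟦ α ⟧ˢ ⟦ abs _ ν∈𝒜 α ⟧ˢ (absᴴ ν∈𝒜 α)
    where open Interpretation ℋ
  Interpretation.tupleᴴ ([ m ]ᴵ ℋ) αs = TupleMap.tupleMap ⟦_⟧ˢ αs ⟦ tuple αs ⟧ˢ (tupleᴴ αs)
    where open Interpretation ℋ
  Interpretation.formerᴴ ([_]ᴵ_ {𝒮} m ℋ) f =
    Former.former ⟦ domain f ⟧ˢ ⟦ base (codomain f) ⟧ˢ (formerᴴ f)
    where
    open Signature 𝒮
    open Interpretation ℋ
  Interpretation.constᴴ ([ m ]ᴵ ℋ) C = m , Interpretation.constᴴ ℋ C
  Interpretation.constᴴ-supp ([ m ]ᴵ ℋ) C p = Interpretation.constᴴ-supp ℋ C (proj₁ p)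

  [_]ⱽ_ : ∀ {𝒮 m} {ℋ : Interpretation 𝒮} → NameList → Valuation 𝒮 ℋ → Valuation 𝒮 ([ m ]ᴵ ℋ)
  Valuation.value      ([ l ]ⱽ ς) X   = l , Valuation.value ς X
  Valuation.value-supp ([ l ]ⱽ ς) X p = Valuation.value-supp ς X (proj₁ p)

{-# OPTIONS --safe #-}
module Submission where

-- The proof is by induction on the term.  For atoms, tuples, term-formers and
-- abstractions the operation of [l]ℋ is compatible with equality, and it can be
-- computed with the list l itself: for an atom, or an denotation-[l] atom, because
-- that atom is not in l.
--
-- What remains is π · [l]x = [l](π · x), where x is the value of a constant or
-- an unknown.  Let S be the set that bounds the support of x, pmss C for a
-- constant C and 𝔸< for an unknown, and let σ = π / S.  Two properties of σ suffice (·-under): it agrees with π on supp x,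
-- and it fixes every atom of l.  Indeed σπ⁻¹ then takes π · l to l and fixes
-- every atom of supp (π · x), so that it witnesses
-- (l , π · x) ∈ 〚 π · l , π · x 〛.
-- The second property is the hypothesis on the atoms of the term.
--
-- The first is /-agrees: π / S agrees with π on S.  Deleting an atom d from
-- a cycle changes the image only of d and of its predecessor (cycle-delete), and
-- d is deleted only if both are outside S.  Breaking a cycle changes the image
-- only of the last atoms of the segments, which are outside S (cut-agrees).
-- Finally the cycles of π are disjoint, cover all atoms moved by π, and each
-- acts like π on its own atoms (cycles-Orbits), so the images in the product of
-- all pieces are determined cycle by cycle (blocks-agrees).

open import Defs
open import Axiom.ExcludedMiddle using (ExcludedMiddle)
open import Data.Product.Base using (_,_)
open import Level using (0ℓ)
open import Relation.Unary using (Empty; _∩_)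

open import Data.Bool.Base using (Bool; true; false; not; if_then_else_)
open import Data.Bool.Properties using (∧-conicalˡ; ∧-conicalʳ)
open import Data.List.Base using (List; []; _∷_; _++_; [_]; concatMap; length)
open import Data.List.Membership.Propositional using () renaming (_∈_ to _∈ₗ_)
open import Data.List.Membership.Propositional.Properties
  using (∈-∃++; ∈-deduplicate⁺; ∈-deduplicate⁻; ∈-filter⁺; ∈-filter⁻)
open import Data.List.Properties using (++-assoc; ++-identityʳ; length-++)
open import Data.List.Relation.Binary.Permutation.Propositional
  using (_↭_; ↭-sym; ↭-trans; ↭-refl; ↭-reflexive; ↭⇒↭ₛ)
open import Data.List.Relation.Binary.Permutation.Propositional.Properties
  using (Any-resp-↭; ↭-length; shift; ++-comm; ∷↭∷ʳ)
import Data.List.Relation.Binary.Permutation.Setoid.Properties as ↭ₛ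
open import Data.List.Relation.Unary.All as All using (All; []; _∷_)
open import Data.List.Relation.Unary.All.Properties using (¬Any⇒All¬; All¬⇒¬Any; ∷ʳ⁺)
open import Data.List.Relation.Unary.AllPairs using (AllPairs; []; _∷_)
open import Data.List.Relation.Unary.Any using (Any; here; there; any?)
import Data.List.Relation.Unary.Any.Properties as Any
open import Data.Nat.Base using (ℕ; zero; suc; _≤_; _+_; z≤n; s≤s)
open import Data.Nat.GeneralisedArithmetic using (fold)
import Data.Nat.Properties as ℕ
open import Data.Product.Base using (∃; ∃₂; _×_; proj₁; proj₂)
open import Data.Sum.Base using (_⊎_; inj₁; inj₂)
open import Function.Base using (_∘_; _on_)
open import Relation.Binary.PropositionalEquality
  using (_≡_; _≢_; refl; sym; trans; cong; subst; resp₂; setoid; module ≡-Reasoning)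
open import Relation.Nullary.Decidable using (Dec; yes; no; ¬?; dec-true; dec-false; decidable-stable)
open import Relation.Nullary.Negation using (¬_; contradiction)
open import Relation.Unary using (Pred; Decidable; _∈_)

private
  variable
    ν : ℕ

-- Lists of atoms

infix 4 _∈ᶜ_

-- x is an entry of c; only the underlying atoms of the entries are compared.
_∈ᶜ_ : Atom → List (𝔸 ν) → Set
x ∈ᶜ c = Any (λ b → x ≡ proj₁ b) c

-- The entries of the list are pairwise distinct atoms.
Distinct : Pred (List (𝔸 ν)) 0ℓ
Distinct = AllPairs (_≢_ on proj₁)

Distinct-resp-↭ : {c d : List (𝔸 ν)} → c ↭ d → Distinct c → Distinct d
Distinct-resp-↭ c↭d =
  ↭ₛ.AllPairs-resp-↭ (setoid _) (_∘ sym) (resp₂ (_≢_ on proj₁)) (↭⇒↭ₛ c↭d)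

head-∉ : ∀ {a : 𝔸 ν} {as} → Distinct (a ∷ as) → ¬ proj₁ a ∈ᶜ as
head-∉ (a≢ ∷ _) = All¬⇒¬Any a≢

Distinct-∷ʳ : ∀ {a : 𝔸 ν} as → ¬ proj₁ a ∈ᶜ as → Distinct as → Distinct (as ++ [ a ])
Distinct-∷ʳ {a = a} as a∉ as! = Distinct-resp-↭ (∷↭∷ʳ a as) (¬Any⇒All¬ as a∉ ∷ as!)

-- The pigeonhole principle for lists.
length-≤ : ∀ (c : List (𝔸 ν)) {as} → Distinct c → (∀ {x} → x ∈ᶜ c → x ∈ₗ as) →
           length c ≤ length as
length-≤ []      _ _ = z≤n
length-≤ (a ∷ c) c!@(_ ∷ c!′) c⊆ with ∈-∃++ (c⊆ (here refl))
... | us , vs , refl = ℕ.≤-trans (s≤s (length-≤ c c!′ rest))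
        (ℕ.≤-reflexive (sym (↭-length (shift (proj₁ a) us vs))))
  where
  rest : ∀ {x} → x ∈ᶜ c → x ∈ₗ us ++ vs
  rest x∈ with Any-resp-↭ (shift (proj₁ a) us vs) (c⊆ (there x∈))
  ... | here refl = contradiction x∈ (head-∉ c!)
  ... | there p   = p

-- end a as is the last entry of the nonempty list a ∷ as.
end : {A : Set} → A → List A → A
end a []       = a
end a (b ∷ bs) = end b bs

end-∷ʳ : {A : Set} (a : A) (as : List A) (b : A) → end a (as ++ [ b ]) ≡ b
end-∷ʳ a []       b = refl
end-∷ʳ a (c ∷ cs) b = end-∷ʳ c cs b

end-∈ᶜ : ∀ (a : 𝔸 ν) as → proj₁ (end a as) ∈ᶜ a ∷ as
end-∈ᶜ a []       = here refl
end-∈ᶜ a (b ∷ bs) = there (end-∈ᶜ b bs)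

-- The permutation of a cycle

⇄-comm : (a b : 𝔸 ν) → a ⇄ b ≈ₚ b ⇄ a
⇄-comm a b c with c ≟ proj₁ a | c ≟ proj₁ b
... | yes refl | _        = trans (⇄-fst a b) (sym (⇄-snd b a))
... | no _     | yes refl = trans (⇄-snd a b) (sym (⇄-fst b a))
... | no c≢a   | no c≢b   = trans (⇄-other a b c≢a c≢b) (sym (⇄-other b a c≢b c≢a))

cycle-fixes : ∀ (c : List (𝔸 ν)) {x} → ¬ x ∈ᶜ c → cycle c ⟨$⟩ x ≡ x
cycle-fixes []           x∉ = refl
cycle-fixes (a ∷ [])     x∉ = refl
cycle-fixes (a ∷ b ∷ bs) x∉ =
  trans (cong ((a ⇄ b) ⟨$⟩_) (cycle-fixes (b ∷ bs) (x∉ ∘ there)))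
    (⇄-other a b (x∉ ∘ here) (x∉ ∘ there ∘ here))

cycle-onto : ∀ (c : List (𝔸 ν)) {x} → x ∈ᶜ c → ∃ λ y → y ∈ᶜ c × cycle c ⟨$⟩ y ≡ x
cycle-onto c {x} x∈ with any? (λ b → (cycle c ⁻¹ ⟨$⟩ x) ≟ proj₁ b) c
... | yes y∈ = _ , y∈ , reverse-inverseʳ (cycle c) x
... | no y∉  = contradiction (subst (_∈ᶜ c) x≡y x∈) y∉
  where
  x≡y : x ≡ cycle c ⁻¹ ⟨$⟩ x
  x≡y = trans (sym (reverse-inverseʳ (cycle c) x)) (cycle-fixes c y∉)

-- The last atom of a cycle is sent to the first; the atoms need not be distinct.
cycle-end : ∀ (a : 𝔸 ν) as → cycle (a ∷ as) ⟨$⟩ proj₁ (end a as) ≡ proj₁ a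
cycle-end a []       = refl
cycle-end a (b ∷ bs) = trans (cong ((a ⇄ b) ⟨$⟩_) (cycle-end b bs)) (⇄-snd a b)

cycle-∷ʳ : ∀ (a : 𝔸 ν) as b → cycle (a ∷ as ++ [ b ]) ≈ₚ cycle (a ∷ as) ∙ (end a as ⇄ b)
cycle-∷ʳ a []       b x = refl
cycle-∷ʳ a (c ∷ cs) b x = cong ((a ⇄ c) ⟨$⟩_) (cycle-∷ʳ c cs b x)

-- By cycle-∷ʳ the right-hand side is cycle as ∙ (z a) with z the last entry of as.
-- Conjugating (z a) by cycle as, which takes z to the first entry b of as and
-- fixes a, turns this into (b a) ∙ cycle as, that is, into the left-hand side.
cycle-rotate₁ : ∀ (a : 𝔸 ν) as → ¬ proj₁ a ∈ᶜ as → cycle (a ∷ as) ≈ₚ cycle (as ++ [ a ])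
cycle-rotate₁ a []       a∉ x = refl
cycle-rotate₁ a (b ∷ bs) a∉ x = sym (begin
  cycle (b ∷ bs ++ [ a ]) ⟨$⟩ x                ≡⟨ cycle-∷ʳ b bs a x ⟩
  (π ∙ (end b bs ⇄ a)) ⟨$⟩ x                   ≡⟨ conj π a (end b bs) x ⟩
  ((π $ₙ end b bs) ⇄ (π $ₙ a)) ⟨$⟩ π ⟨$⟩ x     ≡⟨ ⇄-cong {a = π $ₙ end b bs} {π $ₙ a} {b} {a}
                                                    (cycle-end b bs) (cycle-fixes (b ∷ bs) a∉) (π ⟨$⟩ x) ⟩
  (b ⇄ a) ⟨$⟩ π ⟨$⟩ x                          ≡⟨ ⇄-comm b a (π ⟨$⟩ x) ⟩
  cycle (a ∷ b ∷ bs) ⟨$⟩ x                     ∎)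
  where
  open ≡-Reasoning
  π = cycle (b ∷ bs)

cycle-rotate : ∀ (us vs : List (𝔸 ν)) → Distinct (us ++ vs) → cycle (us ++ vs) ≈ₚ cycle (vs ++ us)
cycle-rotate []       vs d x rewrite ++-identityʳ vs = refl
cycle-rotate (a ∷ us) vs d@(_ ∷ _) x = begin
  cycle (a ∷ us ++ vs) ⟨$⟩ x             ≡⟨ cycle-rotate₁ a (us ++ vs) (head-∉ d) x ⟩
  cycle ((us ++ vs) ++ [ a ]) ⟨$⟩ x      ≡⟨ cong (λ c → cycle c ⟨$⟩ x) (++-assoc us vs [ a ]) ⟩
  cycle (us ++ (vs ++ [ a ])) ⟨$⟩ x      ≡⟨ cycle-rotate us (vs ++ [ a ]) d′ x ⟩
  cycle ((vs ++ [ a ]) ++ us) ⟨$⟩ x      ≡⟨ cong (λ c → cycle c ⟨$⟩ x) (++-assoc vs [ a ] us) ⟩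
  cycle (vs ++ a ∷ us) ⟨$⟩ x             ∎
  where
  open ≡-Reasoning
  d′ : Distinct (us ++ (vs ++ [ a ]))
  d′ = subst Distinct (++-assoc us vs [ a ]) (Distinct-resp-↭ (∷↭∷ʳ a (us ++ vs)) d)

-- Deleting the first atom of a cycle changes only its own image and that of the
-- last atom, which is its predecessor.
cycle-tail : ∀ (a : 𝔸 ν) as {x} → ¬ proj₁ a ∈ᶜ as → x ≢ proj₁ a →
  (∀ {b bs} → as ≡ b ∷ bs → x ≢ proj₁ (end b bs)) →
  cycle as ⟨$⟩ x ≡ cycle (a ∷ as) ⟨$⟩ x
cycle-tail a []       a∉ x≢a x≢end = refl
cycle-tail a (b ∷ bs) a∉ x≢a x≢end = sym (⇄-other a b
  (λ e → x≢a (⟨$⟩-injective (cycle (b ∷ bs)) (trans e (sym (cycle-fixes (b ∷ bs) a∉)))))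
  (λ e → x≢end refl (⟨$⟩-injective (cycle (b ∷ bs)) (trans e (sym (cycle-end b bs))))))

cycle-delete : ∀ (us : List (𝔸 ν)) d vs {x} → Distinct (us ++ d ∷ vs) → x ≢ proj₁ d →
  cycle (us ++ d ∷ vs) ⟨$⟩ x ≢ proj₁ d → cycle (us ++ vs) ⟨$⟩ x ≡ cycle (us ++ d ∷ vs) ⟨$⟩ x
cycle-delete us d vs {x} c! x≢d cx≢d with Distinct-resp-↭ (shift d us vs) c!
... | _ ∷ us++vs! = begin
  cycle (us ++ vs) ⟨$⟩ x        ≡⟨ cycle-rotate us vs us++vs! x ⟩
  cycle (vs ++ us) ⟨$⟩ x        ≡⟨ cycle-tail d (vs ++ us) (head-∉ d!) x≢d x≢end ⟩
  cycle (d ∷ vs ++ us) ⟨$⟩ x    ≡⟨ sym (cycle-rotate us (d ∷ vs) c! x) ⟩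
  cycle (us ++ d ∷ vs) ⟨$⟩ x    ∎
  where
  open ≡-Reasoning
  d! : Distinct (d ∷ vs ++ us)
  d! = Distinct-resp-↭ (++-comm us (d ∷ vs)) c!
  x≢end : ∀ {b bs} → vs ++ us ≡ b ∷ bs → x ≢ proj₁ (end b bs)
  x≢end {b} {bs} e refl = cx≢d (trans (cycle-rotate us (d ∷ vs) c! x)
    (trans (cong (λ c → cycle (d ∷ c) ⟨$⟩ x) e) (cycle-end d (b ∷ bs))))

-- Pruning and breaking a cycle

module _ {S : Pred Atom 0ℓ} (S? : Decidable S) where

  outside⇒∉ : ∀ {a} → outside S? a ≡ true → ¬ S a
  outside⇒∉ {a} p a∈ with S? a
  outside⇒∉ () a∈ | yes _
  ... | no a∉ = a∉ a∈

  module _ {ν : ℕ} where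

    -- The possible outcomes of deleting the first entry that satisfies p.
    data Deleted (p : 𝔸 ν → Bool) : List (𝔸 ν) → List (𝔸 ν) → Set where
      unchanged : ∀ {c} → Deleted p c c
      deleted   : ∀ us d vs → p d ≡ true → Deleted p (us ++ d ∷ vs) (us ++ vs)

    deleteFirst-Deleted : ∀ p c → Deleted p c (deleteFirst S? p c)
    deleteFirst-Deleted p []       = unchanged
    deleteFirst-Deleted p (a ∷ as) with p a in pa | deleteFirst S? p as | deleteFirst-Deleted p as
    ... | true  | _ | _                  = deleted [] a as pa
    ... | false | _ | unchanged          = unchanged
    ... | false | _ | deleted us d vs pd = deleted (a ∷ us) d vs pd

    -- The invariant of pruning: c′ is obtained from c by deletions that do not affect
    -- the image of any atom of S.
    record Pruned (c c′ : List (𝔸 ν)) : Set where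
      field
        distinct : Distinct c′
        sub      : ∀ {x} → x ∈ᶜ c′ → x ∈ᶜ c
        agrees   : ∀ {x} → S x → cycle c′ ⟨$⟩ x ≡ cycle c ⟨$⟩ x

    open Pruned

    deletable-Pruned : ∀ {c c′ c″} → Pruned c c′ → Deleted (deletable S? c′) c′ c″ → Pruned c c″
    deletable-Pruned P unchanged = P
    deletable-Pruned {c} P (deleted us d vs pd) with Distinct-resp-↭ (shift d us vs) (distinct P)
    ... | _ ∷ us++vs! = record
      { distinct = us++vs!
      ; sub      = sub P ∘ Any-resp-↭ (↭-sym (shift d us vs)) ∘ there
      ; agrees   = λ {x} x∈S → trans
          (cycle-delete us d vs (distinct P)
            (λ { refl → outside⇒∉ (∧-conicalˡ _ _ (∧-conicalʳ (outside S? pred) _ pd)) x∈S })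
            -- an atom that is sent to d is the predecessor of d
            (λ e → outside⇒∉ (∧-conicalˡ (outside S? pred) _ pd)
              (subst S (trans (sym (reverse-inverseˡ (cycle c′) x)) (cong (cycle c′ ⁻¹ ⟨$⟩_) e)) x∈S)))
          (agrees P x∈S)
      }
      where
      c′ = us ++ d ∷ vs
      pred = cycle c′ ⁻¹ ⟨$⟩ proj₁ d

    prune-Pruned : ∀ {c} → Distinct c → Pruned c (prune S? c)
    prune-Pruned {c} c! = go (length c)
      where
      go : ∀ n → Pruned c (fold c (λ c′ → deleteFirst S? (deletable S? c′) c′) n)
      go zero    = record { distinct = c! ; sub = λ x∈ → x∈ ; agrees = λ _ → refl }
      go (suc n) = deletable-Pruned (go n) (deleteFirst-Deleted _ _)

    -- The possible outcomes of rotating a list to end at an entry that satisfies p: if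
    -- there is none, the list is left as it is.
    data Rotated (p : 𝔸 ν → Bool) : List (𝔸 ν) → List (𝔸 ν) → Set where
      unbroken : ∀ {c} → All (λ a → p a ≡ false) c → Rotated p c c
      rotated  : ∀ us v vs → p v ≡ true → Rotated p (us ++ v ∷ vs) (vs ++ (us ++ [ v ]))

    -- The recursion defining rotate is a local function of it, so it is characterised
    -- here by its defining equations go-[] and go-∷.  In go us vs, the list us holds
    -- the entries already passed, none of which satisfies p.
    rotate-step : ∀ p (go : List (𝔸 ν) → List (𝔸 ν) → List (𝔸 ν)) →
      (∀ us → go us [] ≡ us) →
      (∀ us v vs → go us (v ∷ vs) ≡ (if p v then vs ++ (us ++ [ v ]) else go (us ++ [ v ]) vs)) →
      ∀ us vs {c} → us ++ vs ≡ c → All (λ a → p a ≡ false) us → Rotated p c (go us vs)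
    rotate-step p go go-[] go-∷ us [] refl none rewrite go-[] us | ++-identityʳ us = unbroken none
    rotate-step p go go-[] go-∷ us (v ∷ vs) refl none with p v in pv | go us (v ∷ vs) | go-∷ us v vs
    ... | true  | _ | refl = rotated us v vs pv
    ... | false | _ | refl =
      rotate-step p go go-[] go-∷ (us ++ [ v ]) vs (++-assoc us [ v ] vs) (∷ʳ⁺ none pv)

    -- The local function of rotate also takes the whole list, c₀ below, as a hidden
    -- argument.  It is obtained by unification: abstracting the whole list and the
    -- entries passed so far makes its arguments in the goal of rotate-Rotated distinct
    -- variables, whence the hole in the type of rotate-continue is determined.
    mutual

      rotate-Rotated : ∀ p c → Rotated p c (rotate S? p c)
      rotate-Rotated p []       = unbroken []
      rotate-Rotated p (a ∷ as) with p a in pa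
      ... | true  = rotated [] a as pa
      ... | false with a ∷ as in a∷as≡c | a List.∷ [] in [a]≡us
      ...   | c | us = rotate-continue p c us as
                (trans (cong (_++ as) (sym [a]≡us)) a∷as≡c) (subst (All _) [a]≡us (pa ∷ []))

      rotate-continue : ∀ p (c₀ us vs : List (𝔸 ν)) → let r = _ in
        ∀ {c} → us ++ vs ≡ c → All (λ a → p a ≡ false) us → Rotated p c r
      rotate-continue p c₀ = rotate-step p _ (λ _ → refl) (λ _ _ _ → refl)

    -- x is the last entry of the list; false of the empty list.
    data EndsWith (x : Atom) : List (𝔸 ν) → Set where
      final : ∀ {a} → x ≡ proj₁ a → EndsWith x (a ∷ [])
      later : ∀ {a as} → EndsWith x as → EndsWith x (a ∷ as)

    EndsWith-∷ʳ : ∀ us {v x} → EndsWith x (us ++ [ v ]) → x ≡ proj₁ v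
    EndsWith-∷ʳ []               (final e) = e
    EndsWith-∷ʳ (u ∷ [])         (later e) = EndsWith-∷ʳ [] e
    EndsWith-∷ʳ (u ∷ us@(_ ∷ _)) (later e) = EndsWith-∷ʳ us e

    EndsWith-end : ∀ (a : 𝔸 ν) as → EndsWith (proj₁ (end a as)) (a ∷ as)
    EndsWith-end a []       = final refl
    EndsWith-end a (b ∷ bs) = later (EndsWith-end b bs)

    splitAfter-∷ : ∀ p (a : 𝔸 ν) as → ∃₂ λ segment segments →
      splitAfter S? p (a ∷ as) ≡ (a ∷ segment) ∷ segments
    splitAfter-∷ p a as with p a | splitAfter S? p as
    ... | true  | segments           = [] , segments , refl
    ... | false | []                 = [] , [] , refl
    ... | false | segment ∷ segments = segment , segments , refl

    -- The product of the cycles into which c is split after the entries satisfying p.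
    cut : (𝔸 ν → Bool) → List (𝔸 ν) → Permutation
    cut p c = concatMap cycle (splitAfter S? p c)

    cut-[_] : ∀ {p} a → cut p (a ∷ []) ≡ ε
    cut-[_] {p} a with p a
    ... | true  = refl
    ... | false = refl

    -- Splitting between a and b amounts to omitting the factor (a b) of the cycle.
    cut-∷ : ∀ p a b bs →
      (p a ≡ true × cut p (a ∷ b ∷ bs) ≡ cut p (b ∷ bs)) ⊎
      (cut p (a ∷ b ∷ bs) ≡ (a ⇄ b) ∙ cut p (b ∷ bs))
    cut-∷ p a b bs with splitAfter-∷ p b bs | p a
    ... | _ , _ , e | true            = inj₁ (refl , refl)
    ... | _ , _ , e | false rewrite e = inj₂ refl

    cut-fixes : ∀ p c {x} → ¬ x ∈ᶜ c → cut p c ⟨$⟩ x ≡ x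
    cut-fixes p []           x∉ = refl
    cut-fixes p (a ∷ [])     x∉ rewrite cut-[_] {p} a = refl
    cut-fixes p (a ∷ b ∷ bs) {x} x∉ with cut-∷ p a b bs | cut-fixes p (b ∷ bs) {x} (x∉ ∘ there)
    ... | inj₁ (_ , e) | ih = trans (cong (_⟨$⟩ x) e) ih
    ... | inj₂ e       | ih = trans (cong (_⟨$⟩ x) e) (trans (cong ((a ⇄ b) ⟨$⟩_) ih)
            (⇄-other a b (x∉ ∘ here) (x∉ ∘ there ∘ here)))

    -- The omitted factor (a b) matters at x only if cycle (b ∷ bs) takes x to a or to
    -- b.  In the first case x is a, after which the list is split; in the second x is
    -- the last entry.  Hence the two hypotheses: the list is not split after x, and
    -- it is not split at all if x is its last entry.
    cut-agrees : ∀ p c {x} → Distinct c → (∀ {a} → p a ≡ true → x ≢ proj₁ a) →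
      (EndsWith x c → All (λ a → p a ≡ false) c) → cut p c ⟨$⟩ x ≡ cycle c ⟨$⟩ x
    cut-agrees p []           _ _ _ = refl
    cut-agrees p (a ∷ [])     _ _ _ rewrite cut-[_] {p} a = refl
    cut-agrees p (a ∷ b ∷ bs) {x} c!@(_ ∷ bs!) x≢ none
      with cut-∷ p a b bs | cut-agrees p (b ∷ bs) bs! x≢ (All.tail ∘ none ∘ later)
    ... | inj₂ e        | ih = trans (cong (_⟨$⟩ x) e) (cong ((a ⇄ b) ⟨$⟩_) ih)
    ... | inj₁ (pa , e) | ih = trans (cong (_⟨$⟩ x) e)
      (trans ih (cycle-tail a (b ∷ bs) (head-∉ c!) (x≢ pa) λ { refl refl →
        contradiction (trans (sym pa) (All.head (none (later (EndsWith-end b bs))))) λ () }))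

    rotated-↭ : ∀ {p c c′} → Rotated p c c′ → c ↭ c′
    rotated-↭ (unbroken _) = ↭-refl
    rotated-↭ (rotated us v vs _) =
      ↭-trans (++-comm us (v ∷ vs)) (↭-trans (∷↭∷ʳ v (vs ++ us)) (↭-reflexive (++-assoc vs us [ v ])))

    rotated-cycle : ∀ {p c c′} → Distinct c → Rotated p c c′ → cycle c ≈ₚ cycle c′
    rotated-cycle c! (unbroken _) x = refl
    rotated-cycle c! (rotated us v vs _) x = trans
      (cong (λ c → cycle c ⟨$⟩ x) (sym (++-assoc us [ v ] vs)))
      (cycle-rotate (us ++ [ v ]) vs (subst Distinct (sym (++-assoc us [ v ] vs)) c!) x)

    rotated-EndsWith : ∀ {p c c′ x} → (∀ {a} → p a ≡ true → x ≢ proj₁ a) → Rotated p c c′ →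
      EndsWith x c′ → All (λ a → p a ≡ false) c′
    rotated-EndsWith x≢ (unbroken none)      _ = none
    rotated-EndsWith x≢ (rotated us v vs pv) e =
      contradiction (EndsWith-∷ʳ (vs ++ us) (subst (EndsWith _) (sym (++-assoc vs us [ v ])) e)) (x≢ pv)

    break-fixes : ∀ c {x} → ¬ x ∈ᶜ c → concatMap cycle (break S? c) ⟨$⟩ x ≡ x
    break-fixes c x∉ = cut-fixes (breakAfter S? c) (rotate S? (breakAfter S? c) c)
      (x∉ ∘ Any-resp-↭ (↭-sym (rotated-↭ (rotate-Rotated (breakAfter S? c) c))))

    break-agrees : ∀ c {x} → Distinct c → S x → concatMap cycle (break S? c) ⟨$⟩ x ≡ cycle c ⟨$⟩ x
    break-agrees c {x} c! x∈S = trans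
      (cut-agrees p (rotate S? p c) (Distinct-resp-↭ (rotated-↭ r) c!) (λ {a} → x≢ {a})
        (rotated-EndsWith (λ {a} → x≢ {a}) r))
      (sym (rotated-cycle c! r x))
      where
      p = breakAfter S? c
      r = rotate-Rotated p c
      x≢ : ∀ {a} → p a ≡ true → x ≢ proj₁ a
      x≢ {a , _} pa refl = outside⇒∉
        (∧-conicalˡ _ _ (∧-conicalʳ (not (outside S? (cycle c ⁻¹ ⟨$⟩ a))) _ pa)) x∈S

    -- The factor of π / S contributed by the cycle c of π.
    block : List (𝔸 ν) → Permutation
    block c = concatMap cycle (break S? (prune S? c))

    block-fixes : ∀ c {x} → Distinct c → ¬ x ∈ᶜ c → block c ⟨$⟩ x ≡ x
    block-fixes c c! x∉ = break-fixes (prune S? c) (x∉ ∘ sub (prune-Pruned c!))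

    block-agrees : ∀ c {x} → Distinct c → S x → block c ⟨$⟩ x ≡ cycle c ⟨$⟩ x
    block-agrees c c! x∈S = trans (break-agrees (prune S? c) (distinct P) x∈S) (agrees P x∈S)
      where P = prune-Pruned c!

-- The cycles of a permutation

infix 4 _∈ᶜˢ_

-- x is an entry of one of the cycles cs.
_∈ᶜˢ_ : Atom → Cycles → Set
x ∈ᶜˢ cs = Any (λ (_ , c) → x ∈ᶜ c) cs

module _ (π : Permutation) where

  -- c is a cycle of π: its entries are distinct, and π permutes them as cycle c does.
  record IsOrbit (c : List (𝔸 ν)) : Set where
    field
      distinct : Distinct c
      agrees   : ∀ {x} → x ∈ᶜ c → cycle c ⟨$⟩ x ≡ π ⟨$⟩ x

  IsOrbit-⁻¹ : ∀ {c : List (𝔸 ν)} → IsOrbit c → ∀ {x} → π ⟨$⟩ x ∈ᶜ c → x ∈ᶜ c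
  IsOrbit-⁻¹ {c = c} O {x} πx∈ with cycle-onto c πx∈
  ... | y , y∈ , e = subst (_∈ᶜ c) (⟨$⟩-injective π (trans (sym (IsOrbit.agrees O y∈)) e)) y∈

  -- a ∷ as is an initial part of the cycle of π through a: distinct moved atoms, each
  -- the image under π of the one before.  The latter is expressed through cycle,
  -- which sends the last atom back to a.
  record IsPath (a : 𝔸 ν) (as : List (𝔸 ν)) : Set where
    field
      distinct : Distinct (a ∷ as)
      agrees   : ∀ {x} → x ∈ᶜ a ∷ as → x ≢ proj₁ (end a as) → cycle (a ∷ as) ⟨$⟩ x ≡ π ⟨$⟩ x
      moves    : ∀ {x} → x ∈ᶜ a ∷ as → x ∈ nontriv π

  ∈-moved : ∀ {x} → x ∈ nontriv π → x ∈ₗ moved π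
  ∈-moved {x} πx≢x with any? (x ≟_) (mentions π)
  ... | yes x∈ = ∈-deduplicate⁺ _≟_ (∈-filter⁺ (λ a → ¬? (π ⟨$⟩ a ≟ a)) x∈ πx≢x)
  ... | no x∉  = contradiction (unmentioned-fixed π x∉) πx≢x

  moved-nontriv : ∀ {x} → x ∈ₗ moved π → x ∈ nontriv π
  moved-nontriv x∈ = proj₂
    (∈-filter⁻ (λ a → ¬? (π ⟨$⟩ a ≟ a)) {xs = mentions π} (∈-deduplicate⁻ _≟_ _ x∈))

  path-closes : ∀ {a : 𝔸 ν} {as} → IsPath a as → π ⟨$⟩ proj₁ (end a as) ≡ proj₁ a → IsOrbit (a ∷ as)
  path-closes {a = a} {as} P e = record { distinct = IsPath.distinct P ; agrees = agree }
    where
    agree : ∀ {x} → x ∈ᶜ a ∷ as → cycle (a ∷ as) ⟨$⟩ x ≡ π ⟨$⟩ x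
    agree {x} x∈ with x ≟ proj₁ (end a as)
    ... | yes refl = trans (cycle-end a as) (sym e)
    ... | no x≢    = IsPath.agrees P x∈ x≢

  -- The image under π of the last atom z is new: an entry of the path is the image
  -- under cycle (a ∷ as) of some entry y, hence is a if y = z, and π y ≠ π z
  -- otherwise.
  path-extends : ∀ {a : 𝔸 ν} {as} → IsPath a as → π ⟨$⟩ proj₁ (end a as) ≢ proj₁ a →
    IsPath a (as ++ [ π $ₙ end a as ])
  path-extends {ν} {a} {as} P πz≢a = record
    { distinct = Distinct-∷ʳ (a ∷ as) b∉ (IsPath.distinct P)
    ; agrees   = λ x∈ x≢ → agree (Any.++⁻ (a ∷ as) x∈) (subst (λ b → _ ≢ proj₁ b) (end-∷ʳ a as b) x≢)
    ; moves    = λ x∈ → move (Any.++⁻ (a ∷ as) x∈)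
    }
    where
    z b : 𝔸 ν
    z = end a as
    b = π $ₙ z
    b∉ : ¬ proj₁ b ∈ᶜ a ∷ as
    b∉ b∈ with cycle-onto (a ∷ as) b∈
    ... | y , y∈ , e with y ≟ proj₁ z
    ...   | yes refl = πz≢a (trans (sym e) (cycle-end a as))
    ...   | no y≢z   = y≢z (⟨$⟩-injective π (trans (sym (IsPath.agrees P y∈ y≢z)) e))
    agree : ∀ {x} → x ∈ᶜ a ∷ as ⊎ x ∈ᶜ [ b ] → x ≢ proj₁ b → cycle (a ∷ as ++ [ b ]) ⟨$⟩ x ≡ π ⟨$⟩ x
    agree (inj₂ (here x≡b)) x≢b = contradiction x≡b x≢b
    agree {x} (inj₁ x∈) x≢b =
      trans (cycle-∷ʳ a as b x) (trans (⟨$⟩-++ (cycle (a ∷ as)) (z ⇄ b) x) (lemma (x ≟ proj₁ z)))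
      where
      lemma : Dec (x ≡ proj₁ z) → cycle (a ∷ as) ⟨$⟩ (z ⇄ b) ⟨$⟩ x ≡ π ⟨$⟩ x
      lemma (yes refl) = trans (cong (cycle (a ∷ as) ⟨$⟩_) (⇄-fst z b)) (cycle-fixes (a ∷ as) b∉)
      lemma (no x≢z)   = trans (cong (cycle (a ∷ as) ⟨$⟩_) (⇄-other z b x≢z x≢b)) (IsPath.agrees P x∈ x≢z)
    move : ∀ {x} → x ∈ᶜ a ∷ as ⊎ x ∈ᶜ [ b ] → x ∈ nontriv π
    move (inj₁ x∈)          = IsPath.moves P x∈
    move (inj₂ (here refl)) = IsPath.moves P (end-∈ᶜ a as) ∘ ⟨$⟩-injective π

  iterates-stop : ∀ (a : 𝔸 ν) n {b} → proj₁ b ≡ proj₁ a → iterates π a (suc n) b ≡ []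
  iterates-stop a n {b} e rewrite dec-true (proj₁ b ≟ proj₁ a) e = refl

  iterates-step : ∀ (a : 𝔸 ν) n {b} → proj₁ b ≢ proj₁ a →
    iterates π a (suc n) b ≡ b ∷ iterates π a n (π $ₙ b)
  iterates-step a n {b} ≢a rewrite dec-false (proj₁ b ≟ proj₁ a) ≢a = refl

  -- The length of moved π suffices for the iterates to return to a: with no fuel left
  -- the path would have more distinct moved atoms than there are.
  iterates-orbit : ∀ (a : 𝔸 ν) as n → IsPath a as → length as + n ≡ length (moved π) →
    IsOrbit (a ∷ as ++ iterates π a n (π $ₙ end a as))
  iterates-orbit a as zero P len = contradiction
    (length-≤ (a ∷ as) (IsPath.distinct P) (∈-moved ∘ IsPath.moves P))
    (ℕ.<⇒≱ (s≤s (ℕ.≤-reflexive (trans (sym len) (ℕ.+-identityʳ (length as))))))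
  iterates-orbit a as (suc n) P len with π ⟨$⟩ proj₁ (end a as) ≟ proj₁ a
  ... | yes e = subst (λ bs → IsOrbit (a ∷ bs))
      (sym (trans (cong (as ++_) (iterates-stop a n e)) (++-identityʳ as))) (path-closes P e)
  ... | no ≢a = subst (λ bs → IsOrbit (a ∷ bs))
      (trans (cong (λ z → (as ++ [ b ]) ++ iterates π a n (π $ₙ z)) (end-∷ʳ a as b))
        (trans (++-assoc as [ b ] _) (cong (as ++_) (sym (iterates-step a n ≢a)))))
      (iterates-orbit a (as ++ [ b ]) n (path-extends P ≢a)
        (trans (cong (_+ n) (length-++ as)) (trans (ℕ.+-assoc (length as) 1 n) len)))
    where b = π $ₙ end a as

  cycleThrough-orbit : ∀ (a : 𝔸 ν) → proj₁ a ∈ nontriv π → IsOrbit (cycleThrough π a)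
  cycleThrough-orbit a πa≢a = iterates-orbit a [] (length (moved π)) (record
    { distinct = [] ∷ []
    ; agrees   = λ { (here refl) x≢ → contradiction refl x≢ }
    ; moves    = λ { (here refl) → πa≢a }
    }) refl

  -- Every property closed under π passes from b to all iterates.
  iterates-All : ∀ {Q : Pred Atom 0ℓ} → (∀ {x} → Q x → Q (π ⟨$⟩ x)) →
    ∀ (a b : 𝔸 ν) n → Q (proj₁ b) → All (Q ∘ proj₁) (iterates π a n b)
  iterates-All step a b zero    q = []
  iterates-All step a b (suc n) q with proj₁ b ≟ proj₁ a
  ... | yes e = subst (All _) (sym (iterates-stop a n e)) []
  ... | no ≢a = subst (All _) (sym (iterates-step a n ≢a)) (q ∷ iterates-All step a (π $ₙ b) n (step q))

  -- Pairwise disjoint cycles of π.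
  data Orbits : Cycles → Set where
    []  : Orbits []
    add : ∀ {ν c cs} → IsOrbit {ν} c → (∀ {x} → x ∈ᶜ c → ¬ x ∈ᶜˢ cs) → Orbits cs →
          Orbits ((ν , c) ∷ cs)

  Orbits-⁻¹ : ∀ {cs} → Orbits cs → ∀ {x} → π ⟨$⟩ x ∈ᶜˢ cs → x ∈ᶜˢ cs
  Orbits-⁻¹ (add O _ Os) (here πx∈)  = here (IsOrbit-⁻¹ O πx∈)
  Orbits-⁻¹ (add O _ Os) (there πx∈) = there (Orbits-⁻¹ Os πx∈)

  cyclesThrough-Orbits : ∀ as → All (nontriv π) as → Orbits (cyclesThrough π as)
  cyclesThrough-Orbits []       _ = []
  cyclesThrough-Orbits (a ∷ as) (πa≢a ∷ as-moved)
    with cyclesThrough-Orbits as as-moved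
       | any? (λ (_ , c) → any? (λ b → a ≟ proj₁ b) c) (cyclesThrough π as)
  ... | Os | yes _ = Os
  ... | Os | no a∉ = add (cycleThrough-orbit (a , refl) πa≢a)
      (λ x∈c x∈cs → let b∉ , x≡b = All.lookupAny fresh x∈c in
        b∉ (subst (_∈ᶜˢ cyclesThrough π as) x≡b x∈cs)) Os
    where
    fresh : All (λ b → ¬ proj₁ b ∈ᶜˢ cyclesThrough π as) (cycleThrough π (a , refl))
    fresh = a∉ ∷ iterates-All (λ x∉ → x∉ ∘ Orbits-⁻¹ Os) (a , refl) (π $ₙ (a , refl))
      (length (moved π)) (a∉ ∘ Orbits-⁻¹ Os)

  ∈-cyclesThrough : ∀ as {x} → x ∈ₗ as → x ∈ᶜˢ cyclesThrough π as
  ∈-cyclesThrough (a ∷ as) x∈ with any? (λ (_ , c) → any? (λ b → a ≟ proj₁ b) c) (cyclesThrough π as)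
  ∈-cyclesThrough (a ∷ as) (here refl) | yes a∈ = a∈
  ∈-cyclesThrough (a ∷ as) (there x∈)  | yes _  = ∈-cyclesThrough as x∈
  ∈-cyclesThrough (a ∷ as) (here refl) | no _   = here (here refl)
  ∈-cyclesThrough (a ∷ as) (there x∈)  | no _   = there (∈-cyclesThrough as x∈)

  cycles-Orbits : Orbits (cycles π)
  cycles-Orbits = cyclesThrough-Orbits (moved π) (All.tabulate moved-nontriv)

  module _ {S : Pred Atom 0ℓ} (S? : Decidable S) where

    -- The product of the factors contributed by the cycles; blocks (cycles π) is π / S.
    blocks : Cycles → Permutation
    blocks = concatMap (λ (_ , c) → block S? c)

    blocks-fixes : ∀ {cs x} → Orbits cs → ¬ x ∈ᶜˢ cs → blocks cs ⟨$⟩ x ≡ x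
    blocks-fixes [] x∉ = refl
    blocks-fixes {(_ , c) ∷ cs} {x} (add O _ Os) x∉ = trans (⟨$⟩-++ (block S? c) (blocks cs) x)
      (trans (cong (block S? c ⟨$⟩_) (blocks-fixes Os (x∉ ∘ there)))
        (block-fixes S? c (IsOrbit.distinct O) (x∉ ∘ here)))

    -- The block of the cycle containing x takes x to π x, and the blocks of the other
    -- cycles fix both atoms.
    blocks-agrees : ∀ {cs x} → Orbits cs → x ∈ᶜˢ cs → S x → blocks cs ⟨$⟩ x ≡ π ⟨$⟩ x
    blocks-agrees {(_ , c) ∷ cs} {x} (add O disjoint Os) (here x∈) x∈S =
      trans (⟨$⟩-++ (block S? c) (blocks cs) x)
        (trans (cong (block S? c ⟨$⟩_) (blocks-fixes Os (disjoint x∈)))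
          (trans (block-agrees S? c (IsOrbit.distinct O) x∈S) (IsOrbit.agrees O x∈)))
    blocks-agrees {(_ , c) ∷ cs} {x} (add O disjoint Os) (there x∈) x∈S =
      trans (⟨$⟩-++ (block S? c) (blocks cs) x)
        (trans (cong (block S? c ⟨$⟩_) (blocks-agrees Os x∈ x∈S))
          (block-fixes S? c (IsOrbit.distinct O) λ πx∈ → disjoint (IsOrbit-⁻¹ O πx∈) x∈))

    /-agrees : ∀ {x} → S x → (π / S?) ⟨$⟩ x ≡ π ⟨$⟩ x
    /-agrees {x} x∈S with any? (λ (_ , c) → any? (λ b → x ≟ proj₁ b) c) (cycles π)
    ... | yes x∈ = blocks-agrees cycles-Orbits x∈ x∈S
    ... | no x∉  = trans (blocks-fixes cycles-Orbits x∉) (sym (decidable-stable (π ⟨$⟩ x ≟ x)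
        (x∉ ∘ ∈-cyclesThrough (moved π) ∘ ∈-moved)))

-- Abstraction by a list

module _ (em : ExcludedMiddle 0ℓ) (l⋆ : Enumeration) where
  open ListAbstraction em l⋆

  -- π · [l]x = [l](π · x) when some σ agrees with π on the support of x and fixes
  -- the atoms of l.
  ·-under : ∀ (X : PNominalSet) π σ l x → let open PNominalSet X in
    (∀ {a} → a ∈ supp x → σ ⟨$⟩ a ≡ π ⟨$⟩ a) → σ ∈ Fix (suppₗ l) →
    PNominalSet._≈_ ([𝕃] X) (π ·ₗ l , π · x) (l , π · x)
  ·-under X π σ l x σ≡π σ-fix = ∈⇒≈[] X (member ρ fixes l≈ (≈-trans (≈-sym (agree σ≡π)) (≈-sym x≈)))
    where
    open PNominalSet X
    open PNominalSetProperties X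
    ρ = σ ∙ π ⁻¹
    ρπ : ∀ a → ρ ⟨$⟩ π ⟨$⟩ a ≡ σ ⟨$⟩ a
    ρπ a = trans (⟨$⟩-++ σ (π ⁻¹) (π ⟨$⟩ a)) (cong (σ ⟨$⟩_) (reverse-inverseˡ π a))
    fixes : ρ ∈ Fix (supp (π · x) ∖ suppₗ (π ·ₗ l))
    fixes (a∈ , _) with supp-·⁻ π x a∈
    ... | b , b∈ , refl = trans (ρπ b) (σ≡π b∈)
    l≈ : l ≈ₗ ρ ·ₗ π ·ₗ l
    l≈ n = sym (trans (·ₗ-‼ ρ (π ·ₗ l) n)
      (trans (cong (ρ ⟨$⟩_) (·ₗ-‼ π l n)) (trans (ρπ (l ‼ n)) (σ-fix (n , refl)))))
    x≈ : ρ · π · x ≈ σ · x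
    x≈ = ≈-trans (≈-sym (·-∙ ρ π x)) (·-congˡ x λ a → trans (⟨$⟩-++ ρ π a) (ρπ a))

  module _ (𝒮 : Signature) (ℋ : Interpretation 𝒮) (ς : Valuation 𝒮 ℋ) (l : NameList) where
    open Interpretation ℋ

    private
      -- A contains no atom of l.
      Disjoint : Pred Atom 0ℓ → Set
      Disjoint A = Empty (A ∩ suppₗ l)

    fix-nontriv : ∀ σ → Disjoint (nontriv σ) → σ ∈ Fix (suppₗ l)
    fix-nontriv σ dis {a} a∈ with σ ⟨$⟩ a ≟ a
    ... | yes σa≡a = σa≡a
    ... | no σa≢a  = contradiction (σa≢a , a∈) (dis a)

    mutual
      denotation-[l] : ∀ {α} (r : Term 𝒮 α) → Disjoint (atoms em r) →
        PNominalSet._≈_ ([𝕃] ⟦ α ⟧ˢ) (⟦ [ l ]ᴵ ℋ , [ l ]ⱽ ς ⟧ r) (l , ⟦ ℋ , ς ⟧ r)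
      denotation-[l] (atm ν∈𝒜 a) dis =
        AtomMap.atomMap-≈ ⟦ name _ ν∈𝒜 ⟧ˢ (atomᴴ ν∈𝒜) a (λ a∈ → dis (proj₁ a) (refl , a∈))
      denotation-[l] (con π C) dis = ·-under ⟦ _ ⟧ˢ π (π / S?) l (constᴴ C)
          (/-agrees π S? ∘ constᴴ-supp C) (fix-nontriv (π / S?) dis)
        where S? = λ a → em {a ∈ Signature.pmss 𝒮 C}
      denotation-[l] (unk π X) dis = ·-under ⟦ _ ⟧ˢ π (π / 𝔸<?) l (Valuation.value ς X)
        (/-agrees π 𝔸<? ∘ Valuation.value-supp ς X) (fix-nontriv (π / 𝔸<?) dis)
      denotation-[l] (app f r) dis = _⟶ᴱ_.cong (Interpretation.formerᴴ ([ l ]ᴵ ℋ) f) (denotation-[l] r dis)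
      denotation-[l] (tup {αs} rs) dis = PNominalSet.≈-trans ([𝕃] ⟦ tuple αs ⟧ˢ)
        (_↣ᴱ_.cong (Interpretation.tupleᴴ ([ l ]ᴵ ℋ) αs) (denotation-[l]* rs dis))
        (TupleMap.tupleMap-≈ ⟦_⟧ˢ αs ⟦ tuple αs ⟧ˢ (tupleᴴ αs) l (⟦ ℋ , ς ⟧* rs))
      denotation-[l] (lam {ν} {α} ν∈𝒜 a r) dis = PNominalSet.≈-trans ([𝕃] ⟦ abs ν ν∈𝒜 α ⟧ˢ)
        (_↣ᴱ_.cong (Interpretation.absᴴ ([ l ]ᴵ ℋ) ν∈𝒜 α)
          (AtomAbstraction.∈⇒≈ₐ ν ([𝕃] ⟦ α ⟧ˢ) a a
            (inj₁ (refl , PNominalSet.≈-sym ([𝕃] ⟦ α ⟧ˢ)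
              (denotation-[l] r λ b (b∈r , b∈l) → dis b (inj₁ b∈r , b∈l))))))
        (AbstractionMap.abstractionMap-≈ ⟦ α ⟧ˢ ⟦ abs ν ν∈𝒜 α ⟧ˢ (absᴴ ν∈𝒜 α) a (⟦ ℋ , ς ⟧ r)
          λ a∈ → dis (proj₁ a) (inj₂ refl , a∈))

      denotation-[l]* : ∀ {αs} (rs : All (Term 𝒮) αs) → Disjoint (atoms* em rs) →
        ActionSet._≈_ (∏ (λ α → [𝕃] ⟦ α ⟧ˢ) αs)
          (⟦ [ l ]ᴵ ℋ , [ l ]ⱽ ς ⟧* rs) (over ⟦_⟧ˢ αs l (⟦ ℋ , ς ⟧* rs))
      denotation-[l]* []       dis = refl
      denotation-[l]* (r ∷ rs) dis = denotation-[l] r (λ a (a∈r , a∈l) → dis a (inj₁ a∈r , a∈l))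
                               , denotation-[l]* rs (λ a (a∈rs , a∈l) → dis a (inj₂ a∈rs , a∈l))

theorem5p2 : (em : ExcludedMiddle 0ℓ) (l⋆ : Enumeration) →
    let open ListAbstraction em l⋆ in
    (𝒮 : Signature) (ℋ : Interpretation 𝒮) (ς : Valuation 𝒮 ℋ)
    {α : Sort (Signature.𝒜 𝒮) (Signature.ℬ 𝒮)} (r : Term 𝒮 α) (l : ∣ 𝕃 ∣) →
    Empty (atoms em r ∩ PNominalSet.supp 𝕃 l) →
    let open PNominalSet (Interpretation.⟦_⟧ˢ ([ l ]ᴵ ℋ) α) in
    ⟦ [ l ]ᴵ ℋ , [ l ]ⱽ ς ⟧ r ≈ (l , ⟦ ℋ , ς ⟧ r)
theorem5p2 em l⋆ 𝒮 ℋ ς r l = denotation-[l] em l⋆ 𝒮 ℋ ς l r
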